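{- The decision problem ColorAvoidingEdgeConnectedComponent is in P. More precisely, given a graph $G$, a color set $C=\{c_1,\ldots,c_k\}$ and a function $c: E(G)\to C$, the color-avoiding edge-connected components of $G$ can be found in polynomial time.
   Context: Let $G$ be a graph, $C=\{c_1,\ldots,c_k\}$ a color set and $c: E(G)\to C$ a function that assigns colors to the edges. For $i\in\{1,\ldots,k\}$, vertices $u,v\in V(G)$ are called $c_i$-avoiding edge-connected if after the removal of the edges of color $c_i$, $u$ and $v$ are in the same component of the remaining graph, i.e. there exists a path between $u$ and $v$ which does not contain any edge of color $c_i$. Vertices $u,v$ are color-avoiding edge-connected if they are $c_i$-avoiding edge-connected for all $i\in\{1,\ldots,k\}$. This is an equivalence relation on $V(G)$; its equivalence classes are called the color-avoiding edge-connected components of $G$. Decision problem ColorAvoidingEdgeConnectedComponent. Instance: a graph $G$, a color set $C=\{c_1,\ldots,c_k\}$, a function $c: E(G)\to C$ and a positive integer $l$. Question: is it true that $G$ has a color-avoiding edge-connected component of size (number of vertices) at least $l$? Polynomial time means polynomial in the size of the input. -}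

module Defs where

open import Data.Bool.Base using (Bool; true)
open import Data.Fin.Base using (Fin; toℕ)
open import Data.Fin.Subset using (Subset; _∈_; ∣_∣)
open import Data.Fin.Subset.Properties using (_∈?_)
open import Data.List.Base
  using (List; []; _∷_; _++_; [_]; length; map; concatMap; filter; allFin)
open import Data.List.Membership.Propositional using () renaming (_∈_ to _∈ₗ_)
open import Data.List.Relation.Unary.Unique.Propositional using (Unique)
open import Data.Maybe.Base using (Maybe; just; nothing)
open import Data.Nat.Base using (ℕ; zero; suc; _+_; _*_; _^_; _≤_; NonZero)
open import Data.Nat.Binary.Base using (ℕᵇ; 2[1+_]; 1+[2_]; fromℕ)
open import Data.Product.Base using (Σ; ∃; ∃-syntax; _×_; _,_)
open import Data.Sum.Base using (_⊎_; inj₁; inj₂)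
open import Data.Vec.Base as Vec using (Vec)
open import Function.Bundles using (_⇔_; _↔_)
open import Relation.Binary.Construct.Closure.ReflexiveTransitive using (Star)
open import Relation.Binary.PropositionalEquality.Core using (_≡_; _≢_)

------------------------------------------------------------------------
-- Edge-coloured graphs

-- Finite undirected graphs; loops and parallel edges are allowed. The two
-- endpoints of an edge are stored in an arbitrary order, which `Joins`
-- disregards.

record Graph : Set where
  field
    #V   : ℕ
    #E   : ℕ
    ends : Fin #E → Fin #V × Fin #V

  Joins : Fin #E → Fin #V → Fin #V → Set
  Joins e u v = ends e ≡ (u , v) ⊎ ends e ≡ (v , u)

record ColouredGraph : Set where
  field
    graph : Graph
    #C    : ℕ

  open Graph graph public

  field
    colour : Fin #E → Fin #C

  -- Adjacency after the removal of the edges of colour i.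
  AvoidingAdjacent : Fin #C → Fin #V → Fin #V → Set
  AvoidingAdjacent i u v = ∃[ e ] colour e ≢ i × Joins e u v

  AvoidingConnected : Fin #C → Fin #V → Fin #V → Set
  AvoidingConnected i = Star (AvoidingAdjacent i)

  ColourAvoidingConnected : Fin #V → Fin #V → Set
  ColourAvoidingConnected u v = ∀ i → AvoidingConnected i u v

  IsComponent : Subset #V → Set
  IsComponent S = ∃[ v ] ∀ w → w ∈ S ⇔ ColourAvoidingConnected v w

  ListsComponents : List (Subset #V) → Set
  ListsComponents Ss = Unique Ss × (∀ S → S ∈ₗ Ss ⇔ IsComponent S)

record Instance : Set where
  field
    input : ColouredGraph
    l     : ℕ
    l>0   : NonZero l

HasLargeComponent : Instance → Set
HasLargeComponent x = ∃[ S ] IsComponent S × l ≤ ∣ S ∣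
  where open Instance x; open ColouredGraph input

------------------------------------------------------------------------
-- Encodings

data Symbol : Set where
  one two comma semicolon : Symbol

-- ℕᵇ is bijective binary notation: digits 1 and 2, least significant digit
-- first, and no digits for 0. The length is logarithmic in the number.
digits : ℕᵇ → List Symbol
digits ℕᵇ.zero  = []
digits 1+[2 n ] = one ∷ digits n
digits 2[1+ n ] = two ∷ digits n

encodeℕ : ℕ → List Symbol
encodeℕ n = digits (fromℕ n) ++ [ comma ]

encodeFin : ∀ {n} → Fin n → List Symbol
encodeFin i = encodeℕ (toℕ i)

-- The list of the vertices, the list of the colours, and the list of the
-- edges, each edge given by its two endpoints and its colour.
encodeGraph : ColouredGraph → List Symbol
encodeGraph G =
  concatMap encodeFin (allFin #V)  ++ [ semicolon ] ++
  concatMap encodeFin (allFin #C)  ++ [ semicolon ] ++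
  concatMap encodeEdge (allFin #E) ++ [ semicolon ]
  where
  open ColouredGraph G
  encodeEdge : Fin #E → List Symbol
  encodeEdge e with ends e
  ... | u , v = encodeFin u ++ encodeFin v ++ encodeFin (colour e)

encodeInstance : Instance → List Symbol
encodeInstance x = encodeGraph input ++ encodeℕ l
  where open Instance x

encodeSubset : ∀ {n} → Subset n → List Symbol
encodeSubset {n} S =
  concatMap encodeFin (filter (_∈? S) (allFin n)) ++ [ semicolon ]

encodeSubsets : ∀ {n} → List (Subset n) → List Symbol
encodeSubsets = concatMap encodeSubset

------------------------------------------------------------------------
-- Deterministic multi-tape Turing machines

Finite : Set → Set
Finite A = ∃[ n ] A ↔ Fin n

data Move : Set where
  left stay right : Move

-- A two-way infinite tape. Both lists start next to the head, and every
-- cell beyond their ends is blank.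
record Tape (Cell : Set) : Set where
  constructor tape
  field
    before : List (Maybe Cell)
    focus  : Maybe Cell
    after  : List (Maybe Cell)

module _ {Cell : Set} where

  blankTape : Tape Cell
  blankTape = tape [] nothing []

  load : List Cell → Tape Cell
  load []       = blankTape
  load (x ∷ xs) = tape [] (just x) (map just xs)

  write : Maybe Cell → Tape Cell → Tape Cell
  write y (tape bs _ as) = tape bs y as

  move : Move → Tape Cell → Tape Cell
  move stay  t                    = t
  move left  (tape []       x as) = tape [] nothing (x ∷ as)
  move left  (tape (b ∷ bs) x as) = tape bs b (x ∷ as)
  move right (tape bs x [])       = tape (x ∷ bs) nothing []
  move right (tape bs x (a ∷ as)) = tape (x ∷ bs) a as

-- The tape alphabet is Maybe (Symbol ⊎ Extra), with `nothing` as the blank.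
-- The machine halts when `δ` is undefined.
record TuringMachine : Set₁ where
  field
    State        : Set
    Extra        : Set
    State-finite : Finite State
    Extra-finite : Finite Extra
    #extraTapes  : ℕ

  #tapes : ℕ
  #tapes = suc #extraTapes

  TapeSymbol : Set
  TapeSymbol = Maybe (Symbol ⊎ Extra)

  field
    start     : State
    accepting : State → Bool
    δ         : State → Vec TapeSymbol #tapes →
                Maybe (State × Vec (TapeSymbol × Move) #tapes)

  record Configuration : Set where
    eta-equality
    constructor config
    field
      state : State
      tapes : Vec (Tape (Symbol ⊎ Extra)) #tapes

  open Configuration public

  initial : List Symbol → Configuration
  initial w =
    config start (load (map inj₁ w) Vec.∷ Vec.replicate #extraTapes blankTape)

  act : TapeSymbol × Move → Tape (Symbol ⊎ Extra) → Tape (Symbol ⊎ Extra)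
  act (y , m) t = move m (write y t)

  step : Configuration → Maybe Configuration
  step (config q ts) with δ q (Vec.map Tape.focus ts)
  ... | nothing         = nothing
  ... | just (q′ , ys) = just (config q′ (Vec.zipWith act ys ts))

  data HaltsIn : ℕ → Configuration → Configuration → Set where
    halt : ∀ {c} → step c ≡ nothing → HaltsIn zero c c
    next : ∀ {t c c′ c″} → step c ≡ just c′ → HaltsIn t c′ c″ →
           HaltsIn (suc t) c c″

  -- The output of a halted machine is read from the head of the first tape
  -- rightwards, up to the first cell that does not hold a `Symbol`.
  symbols : List TapeSymbol → List Symbol
  symbols (just (inj₁ s) ∷ xs) = s ∷ symbols xs
  symbols _                    = []

  output : Configuration → List Symbol
  output c = symbols (Tape.focus t ∷ Tape.after t)
    where
    t : Tape (Symbol ⊎ Extra)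
    t = Vec.head (tapes c)

------------------------------------------------------------------------
-- Polynomial time

RunsInPolyTime : {I : Set} (encode : I → List Symbol) (M : TuringMachine) →
                 (I → TuringMachine.Configuration M → Set) → Set
RunsInPolyTime encode M Post =
  ∃[ a ] ∃[ d ] ∀ x → ∃[ t ] ∃[ c ]
    HaltsIn t (initial (encode x)) c
    × t ≤ a * length (encode x) ^ d + a
    × Post x c
  where open TuringMachine M

InP : {I : Set} → (I → List Symbol) → (I → Set) → Set₁
InP encode Yes =
  Σ TuringMachine λ M → let open TuringMachine M in
    RunsInPolyTime encode M λ x c → accepting (state c) ≡ true ⇔ Yes x

-- Search problems: some solution of each instance has to be output.
SolvableInPolyTime : {I : Set} {O : I → Set} → (I → List Symbol) →
                     (∀ x → O x → List Symbol) → (∀ x → O x → Set) → Set₁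
SolvableInPolyTime encodeI encodeO IsSolution =
  Σ TuringMachine λ M → let open TuringMachine M in
    RunsInPolyTime encodeI M λ x c →
      ∃[ o ] IsSolution x o × output c ≡ encodeO x o

{-# OPTIONS --safe #-}

-- For a colour i, start with every vertex as its own label and let each edge
-- of another colour, in turn, replace the label of one endpoint, wherever it
-- occurs, by the label of the other; in the end two vertices are connected avoiding i if and only
-- if their labels agree. A component consists of the vertices whose labels
-- agree for all colours, and it is listed at its first vertex only.
--
-- For the running time, a function is computed by a program that replaces the
-- encoded argument on top of a stack by the encoded value and leaves whatever
-- is below untouched. Such programs compose, and so the polynomial-time
-- functions are closed under pairing, branching, and folds over lists whose
-- accumulator stays polynomially bounded. As a step pushes at most one symbol
-- on each stack, a bound on the time is also a bound on the size of the value.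

module Submission where

open import Defs

open import Data.Bool.Base using (Bool; T; true; false; not; _∧_; if_then_else_)
open import Data.Fin.Base using (Fin; toℕ)
open import Data.Fin.Patterns using (0F; 1F; 2F)
open import Data.Fin.Properties using (+↔⊎; 1↔⊤; toℕ-injective)
open import Data.Fin.Subset using (Subset; _∈_; ∣_∣)
open import Data.Fin.Subset.Properties using (_∈?_; ⊆-antisym)
open import Data.List.Base as List
  using (List; []; _∷_; _++_; _ʳ++_; [_]; length; map; concatMap; filter;
         reverse; foldr; foldl; allFin; drop; head)
open import Data.List.Membership.Propositional using () renaming (_∈_ to _∈ₗ_)
import Data.List.Membership.Propositional.Properties as Membership
import Data.List.Properties as List
open import Data.List.Relation.Unary.All as All using (All; []; _∷_)
import Data.List.Relation.Unary.All.Properties as All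
open import Data.List.Relation.Unary.Any using (here; there)
import Data.List.Relation.Unary.Any.Properties as Any
open import Data.List.Relation.Unary.Unique.Propositional using (Unique)
import Data.List.Relation.Unary.Unique.Propositional.Properties as Unique
open import Data.Maybe.Base as Maybe using (Maybe; just; nothing)
open import Data.Nat.Base
  using (ℕ; zero; suc; _+_; _*_; _^_; _≤_; z≤n; s≤s; _≡ᵇ_; NonZero)
open import Data.Nat.Binary.Base as Binary using (ℕᵇ; 2[1+_]; 1+[2_]; fromℕ)
import Data.Nat.Binary.Properties as Binary
open import Data.Nat.Properties
open import Data.Nat.Tactic.RingSolver using (solve-∀)
open import Data.Product.Base as Prod using (∃-syntax; _×_; _,_; proj₁; proj₂)
open import Data.Sum.Base using (_⊎_; inj₁; inj₂)
open import Data.Sum.Function.Propositional using (_⊎-↔_)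
open import Data.Unit.Base using (⊤; tt)
open import Data.Vec.Base as Vec using (Vec; []; _∷_; _[_]%=_; lookup)
import Data.Vec.Properties as Vec
open import Data.Vec.Relation.Binary.Pointwise.Inductive using (Pointwise; []; _∷_)
open import Function.Base using (_∘_; id)
open import Function.Bundles using (_⇔_; mk⇔; mk↔ₛ′; Equivalence)
open import Function.Construct.Composition using (_↔-∘_)
open import Function.Construct.Symmetry using (↔-sym)
open import Relation.Binary.Construct.Closure.ReflexiveTransitive as Star
  using (Star; ε; _◅_; _◅◅_)
open import Relation.Binary.Definitions using (DecidableEquality)
open import Relation.Binary.PropositionalEquality hiding ([_])
open import Relation.Nullary.Decidable using (yes; no; does; dec-true; dec-false)
open import Relation.Nullary.Negation using (¬_; contradiction)
open import Relation.Unary using (Decidable)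

-- Polynomials

-- A value on a stack can be read only by consuming it, and moving it to another stack reverses it.
-- Hence encodings are self-delimiting, two scratch stacks stand beside the main one so that two
-- values can be moved apart and taken back in the other order, and `mark`, which no encoding
-- contains, separates scratch data from older contents. Composition alone gives no polynomial bound
-- for a fold, since the bound on one step may compound. Each fold therefore comes with a bound on
-- its accumulator, obtained from additive growth where possible, and for the relabelling from the
-- fact that a label is never longer than the input. No table of labels is stored: a list of
-- replacements is kept, and the label of a vertex is recomputed by replaying it, so that an edge
-- costs at most one new entry. The extra symbol `end` terminates the list of components and thereby
-- stops the reading of the output.

infixl 6 _⊕_
infixl 7 _⊗_

-- Syntax with natural coefficients, so that monotonicity and the substitution of one bound into
-- another hold by structural induction; degree and constant are extracted only once, for the whole
-- machine.
data Poly : Set where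
  con     : ℕ → Poly
  var     : Poly
  _⊕_ _⊗_ : Poly → Poly → Poly

eval : Poly → ℕ → ℕ
eval (con c) n = c
eval var     n = n
eval (p ⊕ q) n = eval p n + eval q n
eval (p ⊗ q) n = eval p n * eval q n

_⟨_⟩ : Poly → Poly → Poly
con c   ⟨ r ⟩ = con c
var     ⟨ r ⟩ = r
(p ⊕ q) ⟨ r ⟩ = p ⟨ r ⟩ ⊕ q ⟨ r ⟩
(p ⊗ q) ⟨ r ⟩ = p ⟨ r ⟩ ⊗ q ⟨ r ⟩

eval-⟨⟩ : ∀ p r n → eval (p ⟨ r ⟩) n ≡ eval p (eval r n)
eval-⟨⟩ (con c) r n = refl
eval-⟨⟩ var     r n = refl
eval-⟨⟩ (p ⊕ q) r n = cong₂ _+_ (eval-⟨⟩ p r n) (eval-⟨⟩ q r n)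
eval-⟨⟩ (p ⊗ q) r n = cong₂ _*_ (eval-⟨⟩ p r n) (eval-⟨⟩ q r n)

eval-mono : ∀ p {m n} → m ≤ n → eval p m ≤ eval p n
eval-mono (con c) m≤n = ≤-refl
eval-mono var     m≤n = m≤n
eval-mono (p ⊕ q) m≤n = +-mono-≤ (eval-mono p m≤n) (eval-mono q m≤n)
eval-mono (p ⊗ q) m≤n = *-mono-≤ (eval-mono p m≤n) (eval-mono q m≤n)

eval-mono-⟨⟩ : ∀ p r {m n} → m ≤ eval r n → eval p m ≤ eval (p ⟨ r ⟩) n
eval-mono-⟨⟩ p r m≤ = ≤-trans (eval-mono p m≤) (≤-reflexive (sym (eval-⟨⟩ p r _)))

^-split-≤ : ∀ n d e → suc n ^ d ≤ suc n ^ (d + e)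
^-split-≤ n d e = ^-monoʳ-≤ (suc n) (m≤m+n d e)

-- The base is `suc n` because raising the exponent must not decrease the power, which fails for the
-- base 0: `0 ^ 0` exceeds `0 ^ 1`.
eval≤a[1+n]^d : ∀ p → ∃[ a ] ∃[ d ] ∀ n → eval p n ≤ a * suc n ^ d
eval≤a[1+n]^d (con c) = c , 0 , λ n → ≤-reflexive (sym (*-identityʳ c))
eval≤a[1+n]^d var     = 1 , 1 , λ n → ≤-trans (n≤1+n n)
  (≤-reflexive (sym (trans (*-identityˡ _) (^-identityʳ (suc n)))))
eval≤a[1+n]^d (p ⊕ q) with eval≤a[1+n]^d p | eval≤a[1+n]^d q
... | a , d , p≤ | b , e , q≤ = a + b , d + e , λ n → begin
  eval p n + eval q n                          ≤⟨ +-mono-≤ (p≤ n) (q≤ n) ⟩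
  a * suc n ^ d + b * suc n ^ e                ≤⟨ +-mono-≤ (*-monoʳ-≤ a (^-split-≤ n d e))
                                                  (*-monoʳ-≤ b (≤-trans (^-split-≤ n e d)
                                                  (≤-reflexive (cong (suc n ^_) (+-comm e d))))) ⟩
  a * suc n ^ (d + e) + b * suc n ^ (d + e)    ≡⟨ *-distribʳ-+ (suc n ^ (d + e)) a b ⟨
  (a + b) * suc n ^ (d + e)                    ∎
  where open ≤-Reasoning
eval≤a[1+n]^d (p ⊗ q) with eval≤a[1+n]^d p | eval≤a[1+n]^d q
... | a , d , p≤ | b , e , q≤ = a * b , d + e , λ n → begin
  eval p n * eval q n                      ≤⟨ *-mono-≤ (p≤ n) (q≤ n) ⟩
  (a * suc n ^ d) * (b * suc n ^ e)        ≡⟨ [m*n]*[o*p]≡[m*o]*[n*p] a (suc n ^ d) b (suc n ^ e) ⟩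
  (a * b) * (suc n ^ d * suc n ^ e)        ≡⟨ cong (a * b *_) (^-distribˡ-+-* (suc n) d e) ⟨
  (a * b) * suc n ^ (d + e)                ∎
  where open ≤-Reasoning

^-distribʳ-* : ∀ d m n → (m * n) ^ d ≡ m ^ d * n ^ d
^-distribʳ-* zero    m n = refl
^-distribʳ-* (suc d) m n =
  trans (cong (m * n *_) (^-distribʳ-* d m n)) ([m*n]*[o*p]≡[m*o]*[n*p] m n (m ^ d) (n ^ d))

-- For positive `n`, `suc n` is at most `2 * n`, whence the factor `2 ^ d`. At 0 the power may
-- vanish, and the additive constant takes over.
eval≤an^d+a : ∀ p → ∃[ a ] ∃[ d ] ∀ n → eval p n ≤ a * n ^ d + a
eval≤an^d+a p with eval≤a[1+n]^d p
... | a , d , p≤ = a * 2 ^ d , d , bound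
  where
  open ≤-Reasoning
  bound : ∀ n → eval p n ≤ a * 2 ^ d * n ^ d + a * 2 ^ d
  bound zero = begin
    eval p 0                             ≤⟨ p≤ 0 ⟩
    a * 1 ^ d                            ≤⟨ *-monoʳ-≤ a (^-monoˡ-≤ d (s≤s {n = 1} z≤n)) ⟩
    a * 2 ^ d                            ≤⟨ m≤n+m _ _ ⟩
    a * 2 ^ d * 0 ^ d + a * 2 ^ d        ∎
  bound n@(suc m) = begin
    eval p n                             ≤⟨ p≤ n ⟩
    a * suc n ^ d                        ≤⟨ *-monoʳ-≤ a (^-monoˡ-≤ d 1+n≤2n) ⟩
    a * (2 * n) ^ d                      ≡⟨ cong (a *_) (^-distribʳ-* d 2 n) ⟩
    a * (2 ^ d * n ^ d)                  ≡⟨ *-assoc a (2 ^ d) (n ^ d) ⟨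
    a * 2 ^ d * n ^ d                    ≤⟨ m≤m+n _ _ ⟩
    a * 2 ^ d * n ^ d + a * 2 ^ d        ∎
    where
    1+n≤2n : suc n ≤ 2 * n
    1+n≤2n = +-mono-≤ {1} (s≤s z≤n) (m≤m+n n 0)

-- Programs on three stacks

data Marker : Set where
  end mark : Marker

Sym : Set
Sym = Symbol ⊎ Marker

rank : Sym → ℕ
rank (inj₁ one)       = 0
rank (inj₁ two)       = 1
rank (inj₁ comma)     = 2
rank (inj₁ semicolon) = 3
rank (inj₂ end)       = 4
rank (inj₂ mark)      = 5

unrank : ℕ → Sym
unrank 0 = inj₁ one
unrank 1 = inj₁ two
unrank 2 = inj₁ comma
unrank 3 = inj₁ semicolon
unrank 4 = inj₂ end
unrank _ = inj₂ mark

unrank-rank : ∀ a → unrank (rank a) ≡ a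
unrank-rank (inj₁ one)       = refl
unrank-rank (inj₁ two)       = refl
unrank-rank (inj₁ comma)     = refl
unrank-rank (inj₁ semicolon) = refl
unrank-rank (inj₂ end)       = refl
unrank-rank (inj₂ mark)      = refl

_≟ˢ_ : DecidableEquality Sym
a ≟ˢ b with rank a ≟ rank b
... | yes eq = yes (trans (sym (unrank-rank a)) (trans (cong unrank eq) (unrank-rank b)))
... | no neq = no (neq ∘ cong rank)

Stacks : Set
Stacks = Vec (List Sym) 3

Tops : Set
Tops = Vec (Maybe Sym) 3

tops : Stacks → Tops
tops = Vec.map head

-- Tests depend only on the three topmost symbols, which are the cells under the heads, so that one
-- transition decides a test.
data Prog : Set where
  skip  : Prog
  push  : Fin 3 → Sym → Prog
  pop   : Fin 3 → Prog
  _⨾_   : Prog → Prog → Prog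
  ifte  : (Tops → Bool) → Prog → Prog → Prog
  while : (Tops → Bool) → Prog → Prog

infixr 5 _⨾_
infix 4 _⊢_⇓[_]_

-- n is only an upper bound on the number of steps of the compiled program.
data _⊢_⇓[_]_ : Prog → Stacks → ℕ → Stacks → Set where
  skip        : ∀ {s} → skip ⊢ s ⇓[ 1 ] s
  push        : ∀ {i a s} → push i a ⊢ s ⇓[ 2 ] s [ i ]%= (a ∷_)
  pop         : ∀ {i s} → pop i ⊢ s ⇓[ 1 ] s [ i ]%= drop 1
  _⨾_         : ∀ {P Q s s′ s″ m n} → P ⊢ s ⇓[ m ] s′ → Q ⊢ s′ ⇓[ n ] s″ →
                (P ⨾ Q) ⊢ s ⇓[ m + n ] s″
  ifte-true   : ∀ {c P Q s s′ n} → c (tops s) ≡ true → P ⊢ s ⇓[ n ] s′ →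
                ifte c P Q ⊢ s ⇓[ suc n ] s′
  ifte-false  : ∀ {c P Q s s′ n} → c (tops s) ≡ false → Q ⊢ s ⇓[ n ] s′ →
                ifte c P Q ⊢ s ⇓[ suc n ] s′
  while-true  : ∀ {c P s s′ s″ m n} → c (tops s) ≡ true →
                P ⊢ s ⇓[ m ] s′ → while c P ⊢ s′ ⇓[ n ] s″ →
                while c P ⊢ s ⇓[ suc (m + n) ] s″
  while-false : ∀ {c P s} → c (tops s) ≡ false → while c P ⊢ s ⇓[ 1 ] s
  weaken      : ∀ {P s s′ m n} → m ≤ n → P ⊢ s ⇓[ m ] s′ → P ⊢ s ⇓[ n ] s′

retarget : ∀ {P s s′ s″ n} → s′ ≡ s″ → P ⊢ s ⇓[ n ] s′ → P ⊢ s ⇓[ n ] s″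
retarget refl run = run

restart : ∀ {P s s′ s″ n} → s ≡ s′ → P ⊢ s ⇓[ n ] s″ → P ⊢ s′ ⇓[ n ] s″
restart refl run = run

-- Compilation to a Turing machine

Cell : Set
Cell = Maybe Sym

SymTape : Set
SymTape = Tape Sym

Action : Set
Action = Cell × Move

actOn : Action → SymTape → SymTape
actOn (y , m) t = move m (write y t)

keep : Cell → Action
keep x = x , stay

-- A push has two states because a machine writes before it moves: one step goes left, a second one
-- writes the new top. A pop erases and moves right in a single step.
St : Prog → Set
St skip          = ⊤
St (push i a)    = ⊤ ⊎ ⊤
St (pop i)       = ⊤
St (P ⨾ Q)       = St P ⊎ St Q
St (ifte c P Q)  = ⊤ ⊎ (St P ⊎ St Q)
St (while c P)   = ⊤ ⊎ St P

⊎-finite : ∀ {A B} → Finite A → Finite B → Finite (A ⊎ B)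
⊎-finite (m , f) (n , g) = m + n , ↔-sym (+↔⊎ {m} {n}) ↔-∘ (f ⊎-↔ g)

⊤-finite : Finite ⊤
⊤-finite = 1 , ↔-sym 1↔⊤

St-finite : ∀ P → Finite (St P)
St-finite skip         = ⊤-finite
St-finite (push i a)   = ⊎-finite ⊤-finite ⊤-finite
St-finite (pop i)      = ⊤-finite
St-finite (P ⨾ Q)      = ⊎-finite (St-finite P) (St-finite Q)
St-finite (ifte c P Q) = ⊎-finite ⊤-finite (⊎-finite (St-finite P) (St-finite Q))
St-finite (while c P)  = ⊎-finite ⊤-finite (St-finite P)

entry : ∀ P → St P
entry skip         = tt
entry (push i a)   = inj₁ tt
entry (pop i)      = tt
entry (P ⨾ Q)      = inj₁ (entry P)
entry (ifte c P Q) = inj₁ tt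
entry (while c P)  = inj₁ tt

keeping : ∀ {n} → Vec Cell n → Vec Action n
keeping = Vec.map keep

actingAt : ∀ {n} → Fin n → (Cell → Action) → Vec Cell n → Vec Action n
actingAt Fin.zero    f (x ∷ xs) = f x ∷ keeping xs
actingAt (Fin.suc i) f (x ∷ xs) = keep x ∷ actingAt i f xs

-- The next state `nothing` stands for leaving the program.
transition : ∀ P → St P → Vec Cell 3 → Maybe (St P) × Vec Action 3
transition skip         tt              v = nothing , keeping v
transition (push i a)   (inj₁ tt)       v = just (inj₂ tt) , actingAt i (_, left) v
transition (push i a)   (inj₂ tt)       v = nothing , actingAt i (λ _ → just a , stay) v
transition (pop i)      tt              v = nothing , actingAt i (λ _ → nothing , right) v
transition (P ⨾ Q)      (inj₁ q)        v =
  Prod.map₁ (λ m → just (Maybe.maybe′ inj₁ (inj₂ (entry Q)) m)) (transition P q v)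
transition (P ⨾ Q)      (inj₂ q)        v = Prod.map₁ (Maybe.map inj₂) (transition Q q v)
transition (ifte c P Q) (inj₁ tt)       v =
  just (inj₂ (if c v then inj₁ (entry P) else inj₂ (entry Q))) , keeping v
transition (ifte c P Q) (inj₂ (inj₁ q)) v = Prod.map₁ (Maybe.map (inj₂ ∘ inj₁)) (transition P q v)
transition (ifte c P Q) (inj₂ (inj₂ q)) v = Prod.map₁ (Maybe.map (inj₂ ∘ inj₂)) (transition Q q v)
transition (while c P)  (inj₁ tt)       v =
  (if c v then just (inj₂ (entry P)) else nothing) , keeping v
transition (while c P)  (inj₂ q)        v =
  Prod.map₁ (λ m → just (Maybe.maybe′ inj₂ (inj₁ tt) m)) (transition P q v)

Tapes : Set
Tapes = Vec SymTape 3

foci : ∀ {n} → Vec SymTape n → Vec Cell n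
foci = Vec.map Tape.focus

stepTapes : ∀ P → St P → Tapes → Tapes
stepTapes P q ts = Vec.zipWith actOn (proj₂ (transition P q (foci ts))) ts

nextState : ∀ P → St P → Tapes → Maybe (St P)
nextState P q ts = proj₁ (transition P q (foci ts))

-- Leaving a program is itself a transition, hence the cost 1 of `skip` and of a failed loop test.
data Exec (P : Prog) : St P → Tapes → ℕ → Tapes → Set where
  exit     : ∀ {q ts} → nextState P q ts ≡ nothing → Exec P q ts 1 (stepTapes P q ts)
  continue : ∀ {q q′ ts n ts′} → nextState P q ts ≡ just q′ →
             Exec P q′ (stepTapes P q ts) n ts′ → Exec P q ts (suc n) ts′

Exec-⨾₂ : ∀ {P Q q ts n ts′} → Exec Q q ts n ts′ → Exec (P ⨾ Q) (inj₂ q) ts n ts′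
Exec-⨾₂ (exit eq)       = exit (cong (Maybe.map inj₂) eq)
Exec-⨾₂ (continue eq e) = continue (cong (Maybe.map inj₂) eq) (Exec-⨾₂ e)

-- The step that leaves `P` already leads to `entry Q`, so the running times add up without
-- overhead.
Exec-⨾₁ : ∀ {P Q q ts m ts′ n ts″} → Exec P q ts m ts′ → Exec Q (entry Q) ts′ n ts″ →
          Exec (P ⨾ Q) (inj₁ q) ts (m + n) ts″
Exec-⨾₁ {Q = Q} (exit eq)       f =
  continue (cong (λ m → just (Maybe.maybe′ inj₁ (inj₂ (entry Q)) m)) eq) (Exec-⨾₂ f)
Exec-⨾₁ {Q = Q} (continue eq e) f =
  continue (cong (λ m → just (Maybe.maybe′ inj₁ (inj₂ (entry Q)) m)) eq) (Exec-⨾₁ e f)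

Exec-then : ∀ {c P Q q ts n ts′} → Exec P q ts n ts′ →
            Exec (ifte c P Q) (inj₂ (inj₁ q)) ts n ts′
Exec-then (exit eq)       = exit (cong (Maybe.map (inj₂ ∘ inj₁)) eq)
Exec-then (continue eq e) = continue (cong (Maybe.map (inj₂ ∘ inj₁)) eq) (Exec-then e)

Exec-else : ∀ {c P Q q ts n ts′} → Exec Q q ts n ts′ →
            Exec (ifte c P Q) (inj₂ (inj₂ q)) ts n ts′
Exec-else (exit eq)       = exit (cong (Maybe.map (inj₂ ∘ inj₂)) eq)
Exec-else (continue eq e) = continue (cong (Maybe.map (inj₂ ∘ inj₂)) eq) (Exec-else e)

Exec-while : ∀ {c P q ts m ts′ n ts″} → Exec P q ts m ts′ →
             Exec (while c P) (inj₁ tt) ts′ n ts″ →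
             Exec (while c P) (inj₂ q) ts (m + n) ts″
Exec-while (exit eq)       f =
  continue (cong (λ m → just (Maybe.maybe′ inj₂ (inj₁ tt) m)) eq) f
Exec-while (continue eq e) f =
  continue (cong (λ m → just (Maybe.maybe′ inj₂ (inj₁ tt) m)) eq) (Exec-while e f)

zipWith-keeping : ∀ {n} (ts : Vec SymTape n) → Vec.zipWith actOn (keeping (foci ts)) ts ≡ ts
zipWith-keeping []       = refl
zipWith-keeping (t ∷ ts) = cong (t ∷_) (zipWith-keeping ts)

zipWith-actingAt : ∀ {n} (i : Fin n) f (ts : Vec SymTape n) →
                   Vec.zipWith actOn (actingAt i f (foci ts)) ts ≡
                   ts [ i ]%= (λ t → actOn (f (Tape.focus t)) t)
zipWith-actingAt Fin.zero    f (t ∷ ts) = cong (_ ∷_) (zipWith-keeping ts)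
zipWith-actingAt (Fin.suc i) f (t ∷ ts) = cong (t ∷_) (zipWith-actingAt i f ts)

-- The top of the stack is under the head and the rest is to its right.
data Holds : List Cell → List Sym → Set where
  []  : ∀ {xs} → All (_≡ nothing) xs → Holds xs []
  _∷_ : ∀ x {xs w} → Holds xs w → Holds (just x ∷ xs) (x ∷ w)

record Represents (t : SymTape) (w : List Sym) : Set where
  constructor represents
  field
    blankBefore : All (_≡ nothing) (Tape.before t)
    holds       : Holds (Tape.focus t ∷ Tape.after t) w

focus-head : ∀ {t w} → Represents t w → Tape.focus t ≡ head w
focus-head (represents _ ([] (eq ∷ _))) = eq
focus-head (represents _ (x ∷ _))       = refl

foci-tops : ∀ {n ts} {s : Vec (List Sym) n} → Pointwise Represents ts s →
            foci ts ≡ Vec.map head s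
foci-tops []       = refl
foci-tops (r ∷ rs) = cong₂ _∷_ (focus-head r) (foci-tops rs)

represents-push : ∀ {t w} a → Represents t w →
                  Represents (write (just a) (move left t)) (a ∷ w)
represents-push {tape []       x as} a (represents []         h) = represents [] (a ∷ h)
represents-push {tape (b ∷ bs) x as} a (represents (eq ∷ eqs) h) = represents eqs (a ∷ h)

represents-pop : ∀ {t w} → Represents t w →
                 Represents (move right (write nothing t)) (drop 1 w)
represents-pop {tape bs x []} (represents bl ([] (_ ∷ _)))     = represents (refl ∷ bl) ([] (refl ∷ []))
represents-pop {tape bs x []} (represents bl (_ ∷ [] []))      = represents (refl ∷ bl) ([] (refl ∷ []))
represents-pop {tape bs x (a ∷ as)} (represents bl ([] (_ ∷ eqs))) = represents (refl ∷ bl) ([] eqs)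
represents-pop {tape bs x (a ∷ as)} (represents bl (_ ∷ h))    = represents (refl ∷ bl) h

Pointwise-updateAt : ∀ {n ts} {s : Vec (List Sym) n} i {f h} →
                     (∀ {t w} → Represents t w → Represents (f t) (h w)) →
                     Pointwise Represents ts s →
                     Pointwise Represents (ts [ i ]%= f) (s [ i ]%= h)
Pointwise-updateAt Fin.zero    fh (r ∷ rs) = fh r ∷ rs
Pointwise-updateAt (Fin.suc i) fh (r ∷ rs) = r ∷ Pointwise-updateAt i fh rs

Simulates : Prog → Tapes → ℕ → Stacks → Set
Simulates P ts n s = ∃[ m ] ∃[ ts′ ] m ≤ n × Exec P (entry P) ts m ts′ × Pointwise Represents ts′ s

simulate : ∀ {P s s′ n ts} → P ⊢ s ⇓[ n ] s′ → Pointwise Represents ts s → Simulates P ts n s′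
simulate {ts = ts} skip rs =
  1 , _ , ≤-refl , exit refl , subst (λ ts → Pointwise Represents ts _) (sym (zipWith-keeping ts)) rs
simulate {ts = ts} (push {i} {a}) rs =
  2 , _ , ≤-refl , continue refl (exit refl) ,
  subst (λ ts → Pointwise Represents ts _)
    -- The move to the left and the write are two updates of the same tape; they are fused into the
    -- single update treated by `represents-push`.
    (sym (trans (zipWith-actingAt i _ _)
         (trans (cong (_[ i ]%= _) (zipWith-actingAt i _ ts)) (Vec.updateAt-updateAt i ts))))
    (Pointwise-updateAt i (represents-push a) rs)
simulate {ts = ts} (pop {i}) rs =
  1 , _ , ≤-refl , exit refl ,
  subst (λ ts → Pointwise Represents ts _) (sym (zipWith-actingAt i _ ts))
    (Pointwise-updateAt i represents-pop rs)
simulate (run₁ ⨾ run₂) rs with simulate run₁ rs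
... | m , _ , m≤ , e , rs′ with simulate run₂ rs′
... | n , _ , n≤ , f , rs″ = m + n , _ , +-mono-≤ m≤ n≤ , Exec-⨾₁ e f , rs″
simulate {ts = ts} (ifte-true {c} {P} {Q} eq run) rs with simulate run rs
... | m , _ , m≤ , e , rs′ = suc m , _ , s≤s m≤ ,
  continue (cong (λ b → just (inj₂ (if b then inj₁ (entry P) else inj₂ (entry Q))))
                 (trans (cong c (foci-tops rs)) eq))
           (subst (λ ts → Exec _ _ ts _ _) (sym (zipWith-keeping ts)) (Exec-then e)) ,
  rs′
simulate {ts = ts} (ifte-false {c} {P} {Q} eq run) rs with simulate run rs
... | m , _ , m≤ , e , rs′ = suc m , _ , s≤s m≤ ,
  continue (cong (λ b → just (inj₂ (if b then inj₁ (entry P) else inj₂ (entry Q))))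
                 (trans (cong c (foci-tops rs)) eq))
           (subst (λ ts → Exec _ _ ts _ _) (sym (zipWith-keeping ts)) (Exec-else e)) ,
  rs′
simulate {ts = ts} (while-true {c} {P} eq run₁ run₂) rs with simulate run₁ rs
... | m , _ , m≤ , e , rs′ with simulate run₂ rs′
... | n , _ , n≤ , f , rs″ = suc (m + n) , _ , s≤s (+-mono-≤ m≤ n≤) ,
  continue (cong (λ b → if b then just (inj₂ (entry P)) else nothing)
                 (trans (cong c (foci-tops rs)) eq))
           (subst (λ ts → Exec _ _ ts _ _) (sym (zipWith-keeping ts)) (Exec-while e f)) ,
  rs″
simulate {ts = ts} (while-false {c} {P} eq) rs =
  1 , _ , ≤-refl ,
  exit (cong (λ b → if b then just (inj₂ (entry P)) else nothing)
             (trans (cong c (foci-tops rs)) eq)) ,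
  subst (λ ts → Pointwise Represents ts _) (sym (zipWith-keeping ts)) rs
simulate (weaken m≤n run) rs with simulate run rs
... | k , _ , k≤m , e , rs′ = k , _ , ≤-trans k≤m m≤n , e , rs′

isSym : Sym → Maybe Sym → Bool
isSym a nothing  = false
isSym a (just b) = does (a ≟ˢ b)

-- Acceptance is read off the state, but a program leaves its answer on the stack; one further step
-- records a test of the top symbol in the state.
data Verdict : Set where
  pending : Verdict
  verdict : Bool → Verdict

Verdict-finite : Finite Verdict
Verdict-finite = 3 , mk↔ₛ′
  (λ { pending → 0F ; (verdict true) → 1F ; (verdict false) → 2F })
  (λ { 0F → pending ; 1F → verdict true ; 2F → verdict false })
  (λ { 0F → refl ; 1F → refl ; 2F → refl })
  (λ { pending → refl ; (verdict true) → refl ; (verdict false) → refl })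

accepted : ∀ {A : Set} → A ⊎ Verdict → Bool
accepted (inj₂ (verdict b)) = b
accepted _                  = false

machineTransition : ∀ P → St P ⊎ Verdict → Vec Cell 3 → Maybe ((St P ⊎ Verdict) × Vec Action 3)
machineTransition P (inj₁ q)           v =
  just (Prod.map₁ (Maybe.maybe′ inj₁ (inj₂ pending)) (transition P q v))
machineTransition P (inj₂ pending)     v =
  just (inj₂ (verdict (isSym (inj₁ one) (Vec.head v))) , keeping v)
machineTransition P (inj₂ (verdict b)) v = nothing

machine : Prog → TuringMachine
machine P = record
  { State        = St P ⊎ Verdict
  ; Extra        = Marker
  ; State-finite = ⊎-finite (St-finite P) Verdict-finite
  ; Extra-finite = 2 , mk↔ₛ′ (λ { end → 0F ; mark → 1F }) (λ { 0F → end ; 1F → mark })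
                             (λ { 0F → refl ; 1F → refl }) (λ { end → refl ; mark → refl })
  ; #extraTapes  = 2
  ; start        = inj₁ (entry P)
  ; accepting    = accepted
  ; δ            = machineTransition P
  }

module _ (P : Prog) where

  open TuringMachine (machine P)

  Exec-HaltsIn : ∀ {q ts n ts′ m c} → Exec P q ts n ts′ →
                 HaltsIn m (config (inj₂ pending) ts′) c →
                 HaltsIn (n + m) (config (inj₁ q) ts) c
  Exec-HaltsIn {q} {ts} (exit eq) h =
    next (cong (λ r → just (config (Maybe.maybe′ inj₁ (inj₂ pending) r) (stepTapes P q ts))) eq) h
  Exec-HaltsIn {q} {ts} (continue eq e) h =
    next (cong (λ r → just (config (Maybe.maybe′ inj₁ (inj₂ pending) r) (stepTapes P q ts))) eq)
         (Exec-HaltsIn e h)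

  HaltsIn-pending : ∀ ts → HaltsIn 1 (config (inj₂ pending) ts)
    (config (inj₂ (verdict (isSym (inj₁ one) (Tape.focus (Vec.head ts))))) ts)
  HaltsIn-pending ts@(t ∷ _) = next (cong (λ ts′ → just (config (inj₂ (verdict (isSym (inj₁ one) (Tape.focus t)))) ts′)) (zipWith-keeping ts)) (halt refl)

  represents-load : ∀ w → Represents (load {Sym} w) w
  represents-load []      = represents [] ([] (refl ∷ []))
  represents-load (x ∷ w) = represents [] (x ∷ holds-map w)
    where
    holds-map : ∀ w → Holds (map just w) w
    holds-map []      = [] []
    holds-map (x ∷ w) = x ∷ holds-map w

  -- The extra step is the one from `pending` to a verdict. It leaves the tapes as they are, so the
  -- same construction serves decision and search.
  machine-correct : ∀ {w v n} → P ⊢ map inj₁ w ∷ [] ∷ [] ∷ [] ⇓[ n ] v ∷ [] ∷ [] ∷ [] →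
                    ∃[ t ] ∃[ c ] HaltsIn t (initial w) c × t ≤ n + 1
                    × accepting (state c) ≡ isSym (inj₁ one) (head v)
                    × Represents (Vec.head (tapes c)) v
  machine-correct {w} run
    with simulate run (represents-load (map inj₁ w) ∷ represents-load [] ∷ represents-load [] ∷ [])
  ... | m , ts@(t ∷ _) , m≤ , e , r ∷ _ =
    m + 1 , _ , Exec-HaltsIn e (HaltsIn-pending ts) , +-monoˡ-≤ 1 m≤ ,
    cong (isSym (inj₁ one)) (focus-head r) , r

  -- `end` is an extra tape symbol and not a `Symbol`, so reading stops in front of it, whatever
  -- follows.
  output-represents : ∀ {c w v} → Represents (Vec.head (tapes c)) (map inj₁ w ++ inj₂ end ∷ v) →
                      output c ≡ w
  output-represents {w = w} (represents _ h) = symbols-holds w h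
    where
    symbols-holds : ∀ w {v xs} → Holds xs (map inj₁ w ++ inj₂ end ∷ v) → symbols xs ≡ w
    symbols-holds []      (_ ∷ h) = refl
    symbols-holds (x ∷ w) (_ ∷ h) = cong (x ∷_) (symbols-holds w h)

-- Loops over stacks

isTop : Fin 3 → Sym → Tops → Bool
isTop i a v = isSym a (lookup v i)

isNotTop : Fin 3 → Sym → Tops → Bool
isNotTop i a v = not (isTop i a v)

isSym-refl : ∀ a → isSym a (just a) ≡ true
isSym-refl a = dec-true (a ≟ˢ a) refl

isSym-≢ : ∀ {a b} → b ≢ a → isSym a (just b) ≡ false
isSym-≢ {a} {b} b≢a = dec-false (a ≟ˢ b) (b≢a ∘ sym)

-- Since `push` has its symbol built in, moving an unknown top needs one branch for each symbol of
-- the alphabet.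
caseTop : Fin 3 → (Sym → Prog) → List Sym → Prog
caseTop i k = foldr (λ a P → ifte (isTop i a) (k a) P) skip

caseTop-run : ∀ {as a i k s s′ n} → a ∈ₗ as → lookup (tops s) i ≡ just a →
              k a ⊢ s ⇓[ n ] s′ → caseTop i k as ⊢ s ⇓[ length as + n ] s′
caseTop-run {b ∷ as} {a} {n = n} a∈ eq run with b ≟ˢ a
... | yes refl = weaken (s≤s (m≤n+m n (length as)))
  (ifte-true (trans (cong (isSym a) eq) (isSym-refl a)) run)
... | no b≢a   = ifte-false (trans (cong (isSym b) eq) (isSym-≢ (b≢a ∘ sym)))
  (caseTop-run (tail-∈ a∈) eq run)
  where
  tail-∈ : a ∈ₗ b ∷ as → a ∈ₗ as
  tail-∈ (here refl) = contradiction refl b≢a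
  tail-∈ (there a∈)  = a∈

allSyms : List Sym
allSyms = map unrank (0 ∷ 1 ∷ 2 ∷ 3 ∷ 4 ∷ 5 ∷ [])

∈-allSyms : ∀ a → a ∈ₗ allSyms
∈-allSyms (inj₁ one)       = here refl
∈-allSyms (inj₁ two)       = there (here refl)
∈-allSyms (inj₁ comma)     = there (there (here refl))
∈-allSyms (inj₁ semicolon) = there (there (there (here refl)))
∈-allSyms (inj₂ end)       = there (there (there (there (here refl))))
∈-allSyms (inj₂ mark)      = there (there (there (there (there (here refl)))))

shift : Fin 3 → Fin 3 → Prog
shift i j = caseTop i (λ a → pop i ⨾ push j a) allSyms

-- At most six tests, one step for `pop` and two for `push`.
shift-run : ∀ {i j a s} → lookup (tops s) i ≡ just a →
            shift i j ⊢ s ⇓[ 9 ] (s [ i ]%= drop 1) [ j ]%= (a ∷_)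
shift-run {i} {j} {a} eq = caseTop-run {k = λ a → pop i ⨾ push j a} (∈-allSyms a) eq (pop ⨾ push)

-- σ w m is the state in which w remains to be processed and m, most recent
-- symbol first, has been processed.
drain : ∀ {P k i a} (σ : List Sym → List Sym → Stacks) →
        (∀ b w m → lookup (tops (σ (b ∷ w) m)) i ≡ just b) →
        (∀ m → lookup (tops (σ [] m)) i ≡ just a) →
        (∀ b w m → P ⊢ σ (b ∷ w) m ⇓[ k ] σ w (b ∷ m)) →
        ∀ {w} m → All (_≢ a) w →
        while (isNotTop i a) P ⊢ σ w m ⇓[ length w * suc k + 1 ] σ [] (w ʳ++ m)
drain {a = a} σ top bottom body {[]} m [] =
  while-false (cong not (trans (cong (isSym a) (bottom m)) (isSym-refl a)))
drain {k = k} {a = a} σ top bottom body {b ∷ w} m (b≢a ∷ avoids) =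
  weaken (≤-reflexive (cong suc (sym (+-assoc k (length w * suc k) 1))))
    (while-true (cong not (trans (cong (isSym a) (top b w m)) (isSym-≢ b≢a)))
                (body b w m) (drain σ top bottom body (b ∷ m) avoids))

All-reverse : ∀ {P : Sym → Set} {w} → All P w → All P (reverse w)
All-reverse ps = All.tabulate (λ a∈ → All.lookup ps (Any.reverse⁻ a∈))

marker : Sym
marker = inj₂ mark

-- Undoes a transfer: the data lie reversed above a marker, so moving them symbol by symbol restores
-- their order, and the marker is dropped.
unload : Fin 3 → Fin 3 → Prog
unload i j = while (isNotTop i marker) (shift i j) ⨾ pop i

-- Per symbol one loop test and at most nine steps of the body; the constant covers the last test
-- and a closing instruction of at most nine steps.
linear : Poly
linear = con 10 ⊗ var ⊕ con 10

reverse-ʳ++ : ∀ (w v : List Sym) → reverse w ʳ++ v ≡ w ++ v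
reverse-ʳ++ w v = trans (List.ʳ++-defn (reverse w)) (cong (_++ v) (List.reverse-involutive w))

loop-cost : ∀ (w : List Sym) {k c} → k ≤ 9 → c ≤ 9 → length w * suc k + 1 + c ≤ eval linear (length w)
loop-cost w {k} {c} k≤9 c≤9 = begin
  length w * suc k + 1 + c    ≡⟨ +-assoc (length w * suc k) 1 c ⟩
  length w * suc k + suc c    ≤⟨ +-mono-≤ (*-monoʳ-≤ (length w) (s≤s k≤9)) (s≤s c≤9) ⟩
  length w * 10 + 10          ≡⟨ cong (_+ 10) (*-comm (length w) 10) ⟩
  10 * length w + 10          ∎
  where open ≤-Reasoning

unload-run : ∀ {i j w} (σ : List Sym → List Sym → Stacks) →
             (∀ b w m → lookup (tops (σ (b ∷ w) m)) i ≡ just b) →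
             (∀ m → lookup (tops (σ [] m)) i ≡ just marker) →
             (∀ b w m → (σ (b ∷ w) m [ i ]%= drop 1) [ j ]%= (b ∷_) ≡ σ w (b ∷ m)) →
             All (_≢ marker) w →
             unload i j ⊢ σ (reverse w) [] ⇓[ eval linear (length w) ] σ [] w [ i ]%= drop 1
unload-run {i} {j} {w} σ top bottom body avoids =
  weaken (≤-trans (loop-cost (reverse w) ≤-refl (s≤s z≤n))
                  (≤-reflexive (cong (eval linear) (List.length-reverse w))))
    (retarget (cong (σ []) (trans (reverse-ʳ++ w []) (List.++-identityʳ w)))
      (drain σ top bottom
        (λ b w m → retarget (body b w m) (shift-run (top b w m))) [] (All-reverse avoids))
     ⨾ pop)

-- For concrete stack indices the side conditions of `unload-run` hold by computation, hence one
-- lemma for each pair of stacks in use.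
unload₁₀-run : ∀ {w} d t u → All (_≢ marker) w →
               unload 1F 0F ⊢ d ∷ (w ʳ++ marker ∷ t) ∷ u ∷ [] ⇓[ eval linear (length w) ]
               (w ++ d) ∷ t ∷ u ∷ []
unload₁₀-run {w} d t u avoids =
  restart (cong (λ v → d ∷ v ∷ u ∷ []) (sym (List.ʳ++-defn w)))
    (unload-run (λ w m → (m ++ d) ∷ (w ++ marker ∷ t) ∷ u ∷ [])
      (λ _ _ _ → refl) (λ _ → refl) (λ _ _ _ → refl) avoids)

unload₂₀-run : ∀ {w} d t u → All (_≢ marker) w →
               unload 2F 0F ⊢ d ∷ t ∷ (w ʳ++ marker ∷ u) ∷ [] ⇓[ eval linear (length w) ]
               (w ++ d) ∷ t ∷ u ∷ []
unload₂₀-run {w} d t u avoids =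
  restart (cong (λ v → d ∷ t ∷ v ∷ []) (sym (List.ʳ++-defn w)))
    (unload-run (λ w m → (m ++ d) ∷ t ∷ (w ++ marker ∷ u) ∷ [])
      (λ _ _ _ → refl) (λ _ → refl) (λ _ _ _ → refl) avoids)

unload₁₂-run : ∀ {w} d t u → All (_≢ marker) w →
               unload 1F 2F ⊢ d ∷ (w ʳ++ marker ∷ t) ∷ u ∷ [] ⇓[ eval linear (length w) ]
               d ∷ t ∷ (w ++ u) ∷ []
unload₁₂-run {w} d t u avoids =
  restart (cong (λ v → d ∷ v ∷ u ∷ []) (sym (List.ʳ++-defn w)))
    (unload-run (λ w m → d ∷ (w ++ marker ∷ t) ∷ (m ++ u) ∷ [])
      (λ _ _ _ → refl) (λ _ → refl) (λ _ _ _ → refl) avoids)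

discard : Fin 3 → Sym → Prog
discard i a = while (isNotTop i a) (pop i) ⨾ pop i

discard₀-run : ∀ {a w} d t u → All (_≢ a) w →
               discard 0F a ⊢ (w ++ a ∷ d) ∷ t ∷ u ∷ [] ⇓[ eval linear (length w) ] d ∷ t ∷ u ∷ []
discard₀-run {a} {w} d t u avoids = weaken (loop-cost w (s≤s z≤n) (s≤s z≤n))
  (drain (λ w _ → (w ++ a ∷ d) ∷ t ∷ u ∷ []) (λ _ _ _ → refl) (λ _ → refl) (λ _ _ _ → pop) [] avoids ⨾ pop)

discard₁-run : ∀ {a w} d t u → All (_≢ a) w →
               discard 1F a ⊢ d ∷ (w ++ a ∷ t) ∷ u ∷ [] ⇓[ eval linear (length w) ] d ∷ t ∷ u ∷ []
discard₁-run {a} {w} d t u avoids = weaken (loop-cost w (s≤s z≤n) (s≤s z≤n))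
  (drain (λ w _ → d ∷ (w ++ a ∷ t) ∷ u ∷ []) (λ _ _ _ → refl) (λ _ → refl) (λ _ _ _ → pop) [] avoids ⨾ pop)

discard₂-run : ∀ {a w} d t u → All (_≢ a) w →
               discard 2F a ⊢ d ∷ t ∷ (w ++ a ∷ u) ∷ [] ⇓[ eval linear (length w) ] d ∷ t ∷ u ∷ []
discard₂-run {a} {w} d t u avoids = weaken (loop-cost w (s≤s z≤n) (s≤s z≤n))
  (drain (λ w _ → d ∷ t ∷ (w ++ a ∷ u) ∷ []) (λ _ _ _ → refl) (λ _ → refl) (λ _ _ _ → pop) [] avoids ⨾ pop)

-- The closing `shift` takes the terminator along: it belongs to the encoded value, unlike the
-- marker that `unload` drops.
moveThrough : Sym → Fin 3 → Prog
moveThrough a j = while (isNotTop 0F a) (shift 0F j) ⨾ shift 0F j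

moveThrough-run : ∀ {a w} (j : Fin 2) d t u → All (_≢ a) w →
                  moveThrough a (Fin.suc j) ⊢ (w ++ a ∷ d) ∷ t ∷ u ∷ [] ⇓[ eval linear (length w) ]
                  d ∷ ((t ∷ u ∷ []) [ j ]%= (λ v → a ∷ w ʳ++ v))
moveThrough-run {a} {w} 0F d t u avoids = weaken (loop-cost w ≤-refl ≤-refl)
  (drain (λ w m → (w ++ a ∷ d) ∷ (m ++ t) ∷ u ∷ []) (λ _ _ _ → refl) (λ _ → refl)
     (λ _ _ _ → shift-run refl) [] avoids
   ⨾ retarget (cong (λ v → d ∷ (a ∷ v) ∷ u ∷ []) (sym (trans (List.ʳ++-defn w) refl))) (shift-run refl))
moveThrough-run {a} {w} 1F d t u avoids = weaken (loop-cost w ≤-refl ≤-refl)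
  (drain (λ w m → (w ++ a ∷ d) ∷ t ∷ (m ++ u) ∷ []) (λ _ _ _ → refl) (λ _ → refl)
     (λ _ _ _ → shift-run refl) [] avoids
   ⨾ retarget (cong (λ v → d ∷ t ∷ (a ∷ v) ∷ []) (sym (List.ʳ++-defn w))) (shift-run refl))

-- Space bounded by time, and inversion of runs

total : ∀ {n} → Vec (List Sym) n → ℕ
total = Vec.sum ∘ Vec.map length

total-updateAt : ∀ {n c f} i (s : Vec (List Sym) n) → (∀ w → length (f w) ≤ length w + c) →
                 total (s [ i ]%= f) ≤ total s + c
total-updateAt {c = c} {f} Fin.zero (w ∷ s) f≤ = begin
  length (f w) + total s      ≤⟨ +-monoˡ-≤ (total s) (f≤ w) ⟩
  length w + c + total s      ≡⟨ lemma (length w) c (total s) ⟩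
  length w + total s + c      ∎
  where
  open ≤-Reasoning
  lemma : ∀ a b c → a + b + c ≡ a + c + b
  lemma = solve-∀
total-updateAt {c = c} {f} (Fin.suc i) (w ∷ s) f≤ = begin
  length w + total (s [ i ]%= f)    ≤⟨ +-monoʳ-≤ (length w) (total-updateAt i s f≤) ⟩
  length w + (total s + c)          ≡⟨ +-assoc (length w) (total s) c ⟨
  length w + total s + c            ∎
  where open ≤-Reasoning

⇓-growth : ∀ {P s n s′} → P ⊢ s ⇓[ n ] s′ → total s′ ≤ total s + n
⇓-growth skip                   = m≤m+n _ 1
⇓-growth {s = s} (push {i})     =
  total-updateAt i s (λ w → ≤-trans (n≤1+n _) (≤-reflexive (+-comm 2 (length w))))
⇓-growth {s = s} (pop {i})      = total-updateAt i s
  (λ w → ≤-trans (≤-reflexive (List.length-drop 1 w)) (≤-trans (m∸n≤m (length w) 1) (m≤m+n (length w) 1)))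
⇓-growth (_⨾_ {s = s} {m = m} {n = n} run₁ run₂) = ≤-trans (⇓-growth run₂)
  (≤-trans (+-monoˡ-≤ n (⇓-growth run₁)) (≤-reflexive (+-assoc (total s) m n)))
⇓-growth {s = s} (ifte-true _ run)      = ≤-trans (⇓-growth run) (+-monoʳ-≤ (total s) (n≤1+n _))
⇓-growth {s = s} (ifte-false _ run)     = ≤-trans (⇓-growth run) (+-monoʳ-≤ (total s) (n≤1+n _))
⇓-growth (while-true {s = s} {m = m} {n = n} _ run₁ run₂) = ≤-trans (⇓-growth run₂)
  (≤-trans (+-monoˡ-≤ n (⇓-growth run₁))
  (≤-trans (≤-reflexive (+-assoc (total s) m n)) (+-monoʳ-≤ (total s) (n≤1+n _))))
⇓-growth (while-false _)        = m≤m+n _ 1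
⇓-growth {s = s} (weaken m≤n run) = ≤-trans (⇓-growth run) (+-monoʳ-≤ (total s) m≤n)

-- Needed because `weaken` may hide the outermost constructor of a run.
⨾-inversion : ∀ {P Q s n s″} → (P ⨾ Q) ⊢ s ⇓[ n ] s″ →
              ∃[ s′ ] ∃[ k ] ∃[ l ] k + l ≤ n × P ⊢ s ⇓[ k ] s′ × Q ⊢ s′ ⇓[ l ] s″
⨾-inversion (run₁ ⨾ run₂)    = _ , _ , _ , ≤-refl , run₁ , run₂
⨾-inversion (weaken m≤n run) with ⨾-inversion run
... | _ , _ , _ , k+l≤ , runs = _ , _ , _ , ≤-trans k+l≤ m≤n , runs

-- Unrolls one iteration with the continuation still attached, for inductions that treat a loop
-- together with the code after it.
while-⨾-true : ∀ {c P Q s s′ s″ m n} → c (tops s) ≡ true → P ⊢ s ⇓[ m ] s′ →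
               (while c P ⨾ Q) ⊢ s′ ⇓[ n ] s″ → (while c P ⨾ Q) ⊢ s ⇓[ suc (m + n) ] s″
while-⨾-true {m = m} eq run₁ run with ⨾-inversion run
... | _ , k , l , k+l≤n , run₂ , run₃ =
  weaken (s≤s (≤-trans (≤-reflexive (+-assoc m k l)) (+-monoʳ-≤ m k+l≤n)))
    (while-true eq run₁ run₂ ⨾ run₃)

-- Encoded types

-- `transfer` witnesses that encodings are self-delimiting: it removes exactly one value although
-- nothing is known about the symbols `d` below. The value arrives reversed.
record Encoding : Set₁ where
  field
    Carrier      : Set
    enc          : Carrier → List Sym
    enc-markless : ∀ x → All (_≢ marker) (enc x)

  size : Carrier → ℕ
  size x = length (enc x)

  field
    transfer     : Fin 2 → Prog
    transferTime : Poly
    transfer-run : ∀ j x d t u →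
      transfer j ⊢ (enc x ++ d) ∷ t ∷ u ∷ [] ⇓[ eval transferTime (size x) ]
      d ∷ ((t ∷ u ∷ []) [ j ]%= (enc x ʳ++_))

product : Encoding → Encoding → Encoding
product A B = record
  { Carrier      = Carrier A × Carrier B
  ; enc          = λ (x , y) → enc A x ++ enc B y
  ; enc-markless = λ (x , y) → All.++⁺ (enc-markless A x) (enc-markless B y)
  ; transfer     = λ j → transfer A j ⨾ transfer B j
  ; transferTime = transferTime A ⊕ transferTime B
  ; transfer-run = λ j (x , y) d t u →
      restart (cong (λ v → v ∷ t ∷ u ∷ []) (sym (List.++-assoc (enc A x) (enc B y) d)))
      (weaken (+-mono-≤ (eval-mono (transferTime A) (size₁ x y)) (eval-mono (transferTime B) (size₂ x y)))
        (transfer-run A j x (enc B y ++ d) t u ⨾ second j x y d t u))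
  }
  where
  open Encoding
  size₁ : ∀ x y → size A x ≤ length (enc A x ++ enc B y)
  size₁ x y = ≤-trans (m≤m+n _ _) (≤-reflexive (sym (List.length-++ (enc A x))))
  size₂ : ∀ x y → size B y ≤ length (enc A x ++ enc B y)
  size₂ x y = ≤-trans (m≤n+m _ (size A x)) (≤-reflexive (sym (List.length-++ (enc A x))))
  second : ∀ j x y d t u →
    transfer B j ⊢ (enc B y ++ d) ∷ ((t ∷ u ∷ []) [ j ]%= (enc A x ʳ++_)) ⇓[ eval (transferTime B) (size B y) ]
    d ∷ ((t ∷ u ∷ []) [ j ]%= ((enc A x ++ enc B y) ʳ++_))
  second 0F x y d t u = retarget (cong (λ v → d ∷ v ∷ u ∷ []) (sym (List.++-ʳ++ (enc A x))))
    (transfer-run B 0F y d _ u)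
  second 1F x y d t u = retarget (cong (λ v → d ∷ t ∷ v ∷ []) (sym (List.++-ʳ++ (enc A x))))
    (transfer-run B 1F y d t _)

terminated-run : ∀ {a w} j d t u → All (_≢ a) w →
  moveThrough a (Fin.suc j) ⊢ ((w ++ [ a ]) ++ d) ∷ t ∷ u ∷ [] ⇓[ eval linear (length (w ++ [ a ])) ]
  d ∷ ((t ∷ u ∷ []) [ j ]%= ((w ++ [ a ]) ʳ++_))
terminated-run {a} {w} j d t u avoids =
  restart (cong (λ v → v ∷ t ∷ u ∷ []) (sym (List.++-assoc w [ a ] d)))
  (weaken (eval-mono linear (≤-trans (m≤m+n (length w) 1) (≤-reflexive (sym (List.length-++ w)))))
  (retarget (cong (d ∷_) (Vec.updateAt-cong j (λ v → sym (List.++-ʳ++ w)) (t ∷ u ∷ [])))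
    (moveThrough-run j d t u avoids)))

boolSym : Bool → Sym
boolSym true  = inj₁ one
boolSym false = inj₁ two

boolean : Encoding
boolean = record
  { Carrier      = Bool
  ; enc          = λ b → [ boolSym b ]
  ; enc-markless = λ { true → (λ ()) ∷ [] ; false → (λ ()) ∷ [] }
  ; transfer     = λ j → shift 0F (Fin.suc j)
  ; transferTime = con 9
  ; transfer-run = λ { 0F b d t u → shift-run refl ; 1F b d t u → shift-run refl }
  }

digitSyms : ℕ → List Sym
digitSyms n = map inj₁ (digits (fromℕ n))

digits-avoid : ∀ {a : Sym} → inj₁ one ≢ a → inj₁ two ≢ a → ∀ b → All (_≢ a) (map inj₁ (digits b))
digits-avoid 1≢ 2≢ ℕᵇ.zero  = []
digits-avoid 1≢ 2≢ 1+[2 b ] = 1≢ ∷ digits-avoid 1≢ 2≢ b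
digits-avoid 1≢ 2≢ 2[1+ b ] = 2≢ ∷ digits-avoid 1≢ 2≢ b

commaless : ∀ n → All (_≢ inj₁ comma) (digitSyms n)
commaless n = digits-avoid (λ ()) (λ ()) (fromℕ n)

natural : Encoding
natural = record
  { Carrier      = ℕ
  ; enc          = λ n → digitSyms n ++ [ inj₁ comma ]
  ; enc-markless = λ n → All.++⁺ (digits-avoid (λ ()) (λ ()) (fromℕ n)) ((λ ()) ∷ [])
  ; transfer     = λ j → moveThrough (inj₁ comma) (Fin.suc j)
  ; transferTime = linear
  ; transfer-run = λ j n d t u → terminated-run j d t u (commaless n)
  }

-- As a does not occur in the elements, the first a is the end of the list.
listOf : ∀ {a} A → a ≢ marker → (∀ x → All (_≢ a) (Encoding.enc A x)) → Encoding
listOf {a} A a≢mark avoids = record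
  { Carrier      = List (Carrier A)
  ; enc          = λ xs → concatMap (enc A) xs ++ [ a ]
  ; enc-markless = λ xs → All.++⁺ (markless* xs) (a≢mark ∷ [])
  ; transfer     = λ j → moveThrough a (Fin.suc j)
  ; transferTime = linear
  ; transfer-run = λ j xs d t u → terminated-run j d t u (avoids* xs)
  }
  where
  open Encoding
  markless* : ∀ xs → All (_≢ marker) (concatMap (enc A) xs)
  markless* []       = []
  markless* (x ∷ xs) = All.++⁺ (enc-markless A x) (markless* xs)
  avoids* : ∀ xs → All (_≢ a) (concatMap (enc A) xs)
  avoids* []       = []
  avoids* (x ∷ xs) = All.++⁺ (avoids x) (avoids* xs)

infixr 5 _⊗ᶜ_

-- The names of the encodings: unlike the encodings, they can be inferred by
-- unification.
data Code : Set
⟦_⟧ : Code → Encoding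
record Listable (a : Sym) (A : Code) : Set

data Code where
  bool nat : Code
  _⊗ᶜ_     : Code → Code → Code
  list     : ∀ {a A} → Listable a A → Code

-- `nonempty` serves twice: it bounds the number of elements by the size of the list, and together
-- with `avoids` it lets the top symbol tell a further element from the end.
record Listable a A where
  inductive
  open Encoding ⟦ A ⟧ using (enc)
  field
    a≢mark   : a ≢ marker
    nonempty : ∀ x → ∃[ b ] ∃[ w ] enc x ≡ b ∷ w
    avoids   : ∀ x → All (_≢ a) (enc x)

⟦ bool ⟧   = boolean
⟦ nat ⟧    = natural
⟦ A ⊗ᶜ B ⟧ = product ⟦ A ⟧ ⟦ B ⟧
⟦ list {a} {A} e ⟧ = listOf ⟦ A ⟧ (Listable.a≢mark e) (Listable.avoids e)

open Listable

module _ (A : Code) where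
  open Encoding ⟦ A ⟧ public

size-⊗ : ∀ A B x y → size (A ⊗ᶜ B) (x , y) ≡ size A x + size B y
size-⊗ A B x y = List.length-++ (enc A x)

-- Polynomial-time functions

record PolyTime (A B : Code) (f : Carrier A → Carrier B) : Set where
  field
    prog : Prog
    time : Poly
    run  : ∀ x d t u → prog ⊢ (enc A x ++ d) ∷ t ∷ u ∷ [] ⇓[ eval time (size A x) ]
                              (enc B (f x) ++ d) ∷ t ∷ u ∷ []

open PolyTime

private
  variable
    A B C Γ S : Code

outSize : {f : Carrier A → Carrier B} → PolyTime A B f → Poly
outSize F = var ⊕ time F

size≤outSize : {f : Carrier A → Carrier B} (F : PolyTime A B f) →
               ∀ x → size B (f x) ≤ eval (outSize F) (size A x)
size≤outSize {A} {B} {f} F x = begin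
  size B (f x)                                 ≡⟨ total-single (enc B (f x)) ⟨
  -- All else on the stacks is taken empty, so that the total is the size of the value itself.
  total ((enc B (f x) ++ []) ∷ [] ∷ [] ∷ [])   ≤⟨ ⇓-growth (run F x [] [] []) ⟩
  total ((enc A x ++ []) ∷ [] ∷ [] ∷ []) + n   ≡⟨ cong (_+ n) (total-single (enc A x)) ⟩
  size A x + n                                 ∎
  where
  open ≤-Reasoning
  n = eval (time F) (size A x)
  total-single : ∀ w → total ((w ++ []) ∷ [] ∷ [] ∷ []) ≡ length w
  total-single w = trans (+-identityʳ _) (cong length (List.++-identityʳ w))

ext-PolyTime : {f g : Carrier A → Carrier B} → (∀ x → f x ≡ g x) → PolyTime A B f → PolyTime A B g
ext-PolyTime {B = B} f≗g F = record
  { prog = prog F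
  ; time = time F
  ; run  = λ x d t u → retarget (cong (λ y → (enc B y ++ d) ∷ t ∷ u ∷ []) (f≗g x)) (run F x d t u)
  }

id-PolyTime : PolyTime A A (λ x → x)
id-PolyTime = record { prog = skip ; time = con 1 ; run = λ x d t u → skip }

infixr 9 _∘ᵖ_

_∘ᵖ_ : {g : Carrier B → Carrier C} {f : Carrier A → Carrier B} →
       PolyTime B C g → PolyTime A B f → PolyTime A C (λ x → g (f x))
_∘ᵖ_ {f = f} G F = record
  { prog = prog F ⨾ prog G
  ; time = time F ⊕ time G ⟨ outSize F ⟩
  ; run  = λ x d t u → run F x d t u ⨾
      weaken (eval-mono-⟨⟩ (time G) (outSize F) (size≤outSize F x)) (run G (f x) d t u)
  }

size-fst : ∀ A B x y → size A x ≤ size (A ⊗ᶜ B) (x , y)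
size-fst A B x y = ≤-trans (m≤m+n _ _) (≤-reflexive (sym (size-⊗ A B x y)))

size-snd : ∀ A B x y → size B y ≤ size (A ⊗ᶜ B) (x , y)
size-snd A B x y = ≤-trans (m≤n+m _ _) (≤-reflexive (sym (size-⊗ A B x y)))

unpair : ∀ A B x y d {t u} →
         _≡_ {A = Stacks} (((enc A x ++ enc B y) ++ d) ∷ t ∷ u ∷ []) ((enc A x ++ enc B y ++ d) ∷ t ∷ u ∷ [])
unpair A B x y d {t} {u} = cong (λ v → v ∷ t ∷ u ∷ []) (List.++-assoc (enc A x) (enc B y) d)

-- The second component is part of the untouched remainder of the stack, so the program is that of
-- `F`.
first-PolyTime : {f : Carrier A → Carrier B} → PolyTime A B f →
                 PolyTime (A ⊗ᶜ C) (B ⊗ᶜ C) (λ (x , y) → f x , y)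
first-PolyTime {A} {B} {C} {f} F = record
  { prog = prog F
  ; time = time F
  ; run  = λ (x , y) d t u → restart (sym (unpair A C x y d)) (retarget (sym (unpair B C (f x) y d))
      (weaken (eval-mono (time F) (size-fst A C x y)) (run F x (enc C y ++ d) t u)))
  }

-- The values are parked on different scratch stacks, each above its own marker, so that they can be
-- taken back in either order.
swap-PolyTime : PolyTime (A ⊗ᶜ B) (B ⊗ᶜ A) (λ (x , y) → y , x)
swap-PolyTime {A} {B} = record
  { prog = push 1F marker ⨾ push 2F marker ⨾ transfer A 0F ⨾ transfer B 1F ⨾
           unload 1F 0F ⨾ unload 2F 0F
  ; time = con 2 ⊕ (con 2 ⊕ (transferTime A ⊕ (transferTime B ⊕ (linear ⊕ linear))))
  ; run  = λ (x , y) d t u → restart (sym (unpair A B x y d)) (retarget (sym (unpair B A y x d))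
      (push ⨾ push
       ⨾ weaken (eval-mono (transferTime A) (size-fst A B x y)) (transfer-run A 0F x _ _ _)
       ⨾ weaken (eval-mono (transferTime B) (size-snd A B x y)) (transfer-run B 1F y _ _ _)
       ⨾ weaken (eval-mono linear (size-fst A B x y)) (unload₁₀-run d t _ (enc-markless A x))
       ⨾ weaken (eval-mono linear (size-snd A B x y)) (unload₂₀-run _ t u (enc-markless B y))))
  }

-- One pass over the reversed value rebuilds it both on the main stack and on the third one. The
-- second copy then goes through the middle stack, so that two reversals bring it to the top in its
-- original orientation.
dup-PolyTime : PolyTime A (A ⊗ᶜ A) (λ x → x , x)
dup-PolyTime {A} = record
  { prog = push 1F marker ⨾ transfer A 0F ⨾ push 2F marker ⨾
           (while (isNotTop 1F marker) copy ⨾ pop 1F) ⨾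
           push 1F marker ⨾ (while (isNotTop 2F marker) (shift 2F 1F) ⨾ pop 2F) ⨾ unload 1F 0F
  ; time = con 2 ⊕ (transferTime A ⊕ (con 2 ⊕ (con 12 ⊗ var ⊕ con 1 ⊕ con 1 ⊕
           (con 2 ⊕ (con 10 ⊗ var ⊕ con 1 ⊕ con 1 ⊕ linear)))))
  ; run  = λ x d t u → retarget (sym (unpair A A x x d))
      (push ⨾ transfer-run A 0F x _ _ _ ⨾ push
       ⨾ (copying x d t u ⨾ pop)
       ⨾ push ⨾ (reloading x d t u ⨾ pop)
       ⨾ unload₁₀-run (enc A x ++ d) t u (enc-markless A x))
  }
  where
  copyTop : Sym → Prog
  copyTop a = pop 1F ⨾ push 0F a ⨾ push 2F a
  copy : Prog
  copy = caseTop 1F copyTop allSyms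
  -- The factor 12: one loop test, six tests of `caseTop`, one step for the `pop` and two for each
  -- `push`.
  copying : ∀ x d t u →
    while (isNotTop 1F marker) copy ⊢ d ∷ (enc A x ʳ++ marker ∷ t) ∷ (marker ∷ u) ∷ []
    ⇓[ 12 * size A x + 1 ] (enc A x ++ d) ∷ (marker ∷ t) ∷ (enc A x ++ marker ∷ u) ∷ []
  copying x d t u =
    restart (cong (λ v → d ∷ v ∷ (marker ∷ u) ∷ []) (sym (List.ʳ++-defn (enc A x))))
    (retarget (cong (λ v → (v ++ d) ∷ (marker ∷ t) ∷ (v ++ marker ∷ u) ∷ [])
                    (trans (reverse-ʳ++ (enc A x) []) (List.++-identityʳ _)))
    (weaken (≤-reflexive (cong (_+ 1) (trans (*-comm (length (reverse (enc A x))) 12) (cong (12 *_) (List.length-reverse (enc A x))))))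
      (drain (λ w m → (m ++ d) ∷ (w ++ marker ∷ t) ∷ (m ++ marker ∷ u) ∷ [])
        (λ _ _ _ → refl) (λ _ → refl)
        (λ a w m → caseTop-run {k = copyTop} (∈-allSyms a) refl (pop ⨾ push ⨾ push))
        [] (All-reverse (enc-markless A x)))))
  reloading : ∀ x d t u →
    while (isNotTop 2F marker) (shift 2F 1F) ⊢
    (enc A x ++ d) ∷ (marker ∷ t) ∷ (enc A x ++ marker ∷ u) ∷ []
    ⇓[ 10 * size A x + 1 ] (enc A x ++ d) ∷ (enc A x ʳ++ marker ∷ t) ∷ (marker ∷ u) ∷ []
  reloading x d t u =
    retarget (cong (λ v → (enc A x ++ d) ∷ v ∷ (marker ∷ u) ∷ []) (sym (List.ʳ++-defn (enc A x))))
    (weaken (≤-reflexive (cong (_+ 1) (*-comm (size A x) 10)))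
      (drain (λ w m → (enc A x ++ d) ∷ (m ++ marker ∷ t) ∷ (w ++ marker ∷ u) ∷ [])
        (λ _ _ _ → refl) (λ _ → refl) (λ _ _ _ → shift-run refl) [] (enc-markless A x)))

π₂ : PolyTime (A ⊗ᶜ B) B proj₂
π₂ {A} {B} = record
  { prog = push 1F marker ⨾ transfer A 0F ⨾ discard 1F marker
  ; time = con 2 ⊕ (transferTime A ⊕ linear)
  ; run  = λ (x , y) d t u → restart (sym (unpair A B x y d))
      (push ⨾ weaken (eval-mono (transferTime A) (size-fst A B x y)) (transfer-run A 0F x _ _ _)
       ⨾ weaken (eval-mono linear (≤-trans (≤-reflexive (List.length-reverse (enc A x))) (size-fst A B x y)))
           (restart (cong (λ v → (enc B y ++ d) ∷ v ∷ u ∷ []) (sym (List.ʳ++-defn (enc A x))))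
             (discard₁-run (enc B y ++ d) t u (All-reverse (enc-markless A x)))))
  }

π₁ : PolyTime (A ⊗ᶜ B) A proj₁
π₁ = π₂ ∘ᵖ swap-PolyTime

infix 4 ⟪_,_⟫

⟪_,_⟫ : {f : Carrier Γ → Carrier A} {g : Carrier Γ → Carrier B} →
        PolyTime Γ A f → PolyTime Γ B g → PolyTime Γ (A ⊗ᶜ B) (λ γ → f γ , g γ)
⟪ F , G ⟫ = swap-PolyTime ∘ᵖ first-PolyTime G ∘ᵖ swap-PolyTime ∘ᵖ first-PolyTime F ∘ᵖ dup-PolyTime

pushAll : List Sym → Prog
pushAll = foldr (λ a P → P ⨾ push 0F a) skip

pushAll-run : ∀ w d t u → pushAll w ⊢ d ∷ t ∷ u ∷ [] ⇓[ 1 + length w * 2 ] (w ++ d) ∷ t ∷ u ∷ []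
pushAll-run []      d t u = skip
pushAll-run (a ∷ w) d t u = weaken (≤-reflexive (cong suc (+-comm (length w * 2) 2))) (pushAll-run w d t u ⨾ push)

-- Pushing a fixed word on top of the argument yields the encoding of a pair, whose second component
-- the projection removes.
const-PolyTime : ∀ y → PolyTime Γ B (λ _ → y)
const-PolyTime {Γ} {B} y = π₁ {B} {Γ} ∘ᵖ record
  { prog = pushAll (enc B y)
  ; time = con (1 + size B y * 2)
  ; run  = λ x d t u → retarget (sym (unpair B Γ y x d)) (pushAll-run (enc B y) (enc Γ x ++ d) t u)
  }

branch-PolyTime : {f g : Carrier Γ → Carrier A} → PolyTime Γ A f → PolyTime Γ A g →
                  PolyTime (bool ⊗ᶜ Γ) A (λ (b , γ) → if b then f γ else g γ)
branch-PolyTime {Γ} {A} F G = record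
  { prog = ifte (isTop 0F (inj₁ one)) (pop 0F ⨾ prog F) (pop 0F ⨾ prog G)
  ; time = con 1 ⊕ (con 1 ⊕ (time F ⊕ time G))
  ; run  = λ
      { (true , γ) d t u → ifte-true refl (pop ⨾ weaken
          (≤-trans (eval-mono (time F) (n≤1+n _)) (m≤m+n _ _)) (run F γ d t u))
      ; (false , γ) d t u → ifte-false refl (pop ⨾ weaken
          (≤-trans (eval-mono (time G) (n≤1+n _)) (m≤n+m _ _)) (run G γ d t u)) }
  }

if-PolyTime : {c : Carrier Γ → Bool} {f g : Carrier Γ → Carrier A} →
              PolyTime Γ bool c → PolyTime Γ A f → PolyTime Γ A g →
              PolyTime Γ A (λ γ → if c γ then f γ else g γ)
if-PolyTime C F G = branch-PolyTime F G ∘ᵖ ⟪ C , id-PolyTime ⟫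

-- Arithmetic

sameTop : Tops → Bool
sameTop v = same (lookup v 0F) (lookup v 2F)
  where
  same : Maybe Sym → Maybe Sym → Bool
  same nothing  _ = false
  same (just a) m = isSym a m

comparable : Tops → Bool
comparable v = isNotTop 0F (inj₁ comma) v ∧ sameTop v

_≡ᵇʷ_ : List Sym → List Sym → Bool
[]      ≡ᵇʷ []      = true
[]      ≡ᵇʷ (b ∷ v) = false
(a ∷ w) ≡ᵇʷ []      = false
(a ∷ w) ≡ᵇʷ (b ∷ v) = does (b ≟ˢ a) ∧ (w ≡ᵇʷ v)

≡ᵇʷ-refl : ∀ w → (w ≡ᵇʷ w) ≡ true
≡ᵇʷ-refl []      = refl
≡ᵇʷ-refl (a ∷ w) = cong₂ _∧_ (isSym-refl a) (≡ᵇʷ-refl w)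

≡ᵇʷ⇒≡ : ∀ w v → (w ≡ᵇʷ v) ≡ true → w ≡ v
≡ᵇʷ⇒≡ []      []      eq = refl
≡ᵇʷ⇒≡ (a ∷ w) (b ∷ v) eq with b ≟ˢ a
... | yes refl = cong (a ∷_) (≡ᵇʷ⇒≡ w v eq)

-- The loop stops at the comma of the number on the main stack or at the first difference. After it,
-- equal tops can only be the two commas, so `sameTop` gives the answer, and what is left of both
-- numbers is discarded.
compareProg : Prog
compareProg = while comparable (pop 0F ⨾ pop 2F) ⨾ ifte sameTop (finish true) (finish false)
  where
  finish : Bool → Prog
  finish b = discard 0F (inj₁ comma) ⨾ discard 2F (inj₁ comma) ⨾ push 0F (boolSym b)

-- Ten steps per symbol pay for discarding it; removing a pair of equal symbols costs only three.
-- The fixed costs of the two tests, the two discards and the push amount to 24, which 30 exceeds.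
compareProg-run : ∀ {w v} d t u → All (_≢ inj₁ comma) w → All (_≢ inj₁ comma) v →
  compareProg ⊢ (v ++ inj₁ comma ∷ d) ∷ t ∷ (w ++ inj₁ comma ∷ u) ∷ []
  ⇓[ 10 * length v + 10 * length w + 30 ] (boolSym (w ≡ᵇʷ v) ∷ d) ∷ t ∷ u ∷ []
compareProg-run {[]} {[]} d t u [] [] = weaken (m≤m+n 24 6)
  (while-false refl ⨾ ifte-true refl (discard₀-run d t _ [] ⨾ discard₂-run d t u [] ⨾ push))
compareProg-run {[]} {b ∷ v} d t u [] v≢ = weaken (cost (length v))
  (while-false (cong₂ _∧_ (cong not (isSym-≢ (All.head v≢))) (isSym-≢ (All.head v≢ ∘ sym)))
   ⨾ ifte-false (isSym-≢ (All.head v≢ ∘ sym)) (discard₀-run d t _ v≢ ⨾ discard₂-run d t u [] ⨾ push))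
  where
  cost : ∀ n → 1 + suc (10 * suc n + 10 + (10 + 2)) ≤ 10 * suc n + 0 + 30
  cost n = ≤-trans (m≤m+n _ 6) (≤-reflexive (arith n))
    where
    arith : ∀ n → 1 + suc (10 * suc n + 10 + (10 + 2)) + 6 ≡ 10 * suc n + 0 + 30
    arith = solve-∀
compareProg-run {a ∷ w} {[]} d t u w≢ [] = weaken (cost (length w))
  (while-false refl ⨾ ifte-false (isSym-≢ (All.head w≢))
     (discard₀-run d t _ [] ⨾ discard₂-run d t u w≢ ⨾ push))
  where
  cost : ∀ n → 1 + suc (10 + (10 * suc n + 10 + 2)) ≤ 0 + 10 * suc n + 30
  cost n = ≤-trans (m≤m+n _ 6) (≤-reflexive (arith n))
    where
    arith : ∀ n → 1 + suc (10 + (10 * suc n + 10 + 2)) + 6 ≡ 0 + 10 * suc n + 30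
    arith = solve-∀
compareProg-run {a ∷ w} {b ∷ v} d t u (a≢ ∷ w≢) (b≢ ∷ v≢) with b ≟ˢ a in b≟a
... | yes refl = weaken (cost (length v) (length w))
  (while-⨾-true (cong₂ _∧_ (cong not (isSym-≢ b≢)) (isSym-refl b)) (pop ⨾ pop)
    (compareProg-run d t u w≢ v≢))
  where
  cost : ∀ m n → suc (2 + (10 * m + 10 * n + 30)) ≤ 10 * suc m + 10 * suc n + 30
  cost m n = ≤-trans (m≤m+n _ 17) (≤-reflexive (arith m n))
    where
    arith : ∀ m n → suc (2 + (10 * m + 10 * n + 30)) + 17 ≡ 10 * suc m + 10 * suc n + 30
    arith = solve-∀
... | no b≢a   = weaken (cost (length v) (length w))
  (while-false (cong₂ _∧_ (cong not (isSym-≢ b≢)) (isSym-≢ (b≢a ∘ sym)))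
   ⨾ ifte-false (isSym-≢ (b≢a ∘ sym))
     (discard₀-run d t _ (b≢ ∷ v≢) ⨾ discard₂-run d t u (a≢ ∷ w≢) ⨾ push))
  where
  cost : ∀ m n → 1 + suc (10 * suc m + 10 + (10 * suc n + 10 + 2)) ≤ 10 * suc m + 10 * suc n + 30
  cost m n = ≤-trans (m≤m+n _ 6) (≤-reflexive (arith m n))
    where
    arith : ∀ m n → 1 + suc (10 * suc m + 10 + (10 * suc n + 10 + 2)) + 6 ≡ 10 * suc m + 10 * suc n + 30
    arith = solve-∀

digits-injective : ∀ {b c} → map {B = Sym} inj₁ (digits b) ≡ map inj₁ (digits c) → b ≡ c
digits-injective {ℕᵇ.zero}  {ℕᵇ.zero}  eq = refl
digits-injective {1+[2 b ]} {1+[2 c ]} eq = cong 1+[2_] (digits-injective (List.∷-injectiveʳ eq))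
digits-injective {2[1+ b ]} {2[1+ c ]} eq = cong 2[1+_] (digits-injective (List.∷-injectiveʳ eq))

-- Bijective numeration gives each number exactly one digit word, so comparing words decides
-- equality.
digitSyms-≡ᵇ : ∀ m n → (digitSyms m ≡ᵇʷ digitSyms n) ≡ (m ≡ᵇ n)
digitSyms-≡ᵇ m n with m ≟ n
... | yes refl = trans (≡ᵇʷ-refl (digitSyms m)) (sym (dec-true (m ≟ m) refl))
... | no m≢n with digitSyms m ≡ᵇʷ digitSyms n in eq
... | true  = contradiction
  (Binary.fromℕ-injective (digits-injective (≡ᵇʷ⇒≡ (digitSyms m) (digitSyms n) eq))) m≢n
... | false = sym (dec-false (m ≟ n) m≢n)

nat-enc : ∀ n (d : List Sym) → (digitSyms n ++ [ inj₁ comma ]) ++ d ≡ digitSyms n ++ inj₁ comma ∷ d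
nat-enc n d = List.++-assoc (digitSyms n) [ inj₁ comma ] d

digitSyms≤size : ∀ n → length (digitSyms n) ≤ size nat n
digitSyms≤size n = ≤-trans (m≤m+n _ 1) (≤-reflexive (sym (List.length-++ (digitSyms n))))

-- The transfer reverses `m`; moving it on to the third stack restores its orientation, so that both
-- numbers are compared from the least significant digit.
equal-PolyTime : PolyTime (nat ⊗ᶜ nat) bool (λ (m , n) → m ≡ᵇ n)
equal-PolyTime = record
  { prog = push 1F marker ⨾ transfer nat 0F ⨾ unload 1F 2F ⨾ compareProg
  ; time = con 2 ⊕ (linear ⊕ (linear ⊕ (con 10 ⊗ var ⊕ con 10 ⊗ var ⊕ con 30)))
  ; run  = λ (m , n) d t u → restart (sym (unpair nat nat m n d))
      (push ⨾ weaken (eval-mono linear (size-fst nat nat m n)) (transfer-run nat 0F m _ _ _)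
       ⨾ weaken (eval-mono linear (size-fst nat nat m n)) (unload₁₂-run _ t u (enc-markless nat m))
       ⨾ weaken (+-monoˡ-≤ 30 (+-mono-≤
           (*-monoʳ-≤ 10 (≤-trans (digitSyms≤size n) (size-snd nat nat m n)))
           (*-monoʳ-≤ 10 (≤-trans (digitSyms≤size m) (size-fst nat nat m n)))))
         (restart (cong₂ (λ v w → v ∷ t ∷ w ∷ []) (sym (nat-enc n d)) (sym (nat-enc m u)))
         (retarget (cong (λ b → (boolSym b ∷ d) ∷ t ∷ u ∷ []) (digitSyms-≡ᵇ m n))
         (compareProg-run d t u (commaless m) (commaless n)))))
  }

-- Adding one in bijective binary: a digit 2 becomes 1 and passes the carry on, a digit 1 becomes 2
-- and absorbs it, and a carry past the last digit becomes a new digit 1.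
carryProg : Prog
carryProg = while (isTop 0F (inj₁ two)) (pop 0F ⨾ push 1F (inj₁ one)) ⨾
            ifte (isTop 0F (inj₁ one)) (pop 0F ⨾ push 0F (inj₁ two)) (push 0F (inj₁ one))

-- `w` holds the digits that passed the carry on, parked in reverse above `t`, and `v` what remains
-- on the main stack; the bound on `w` pays for taking it back.
carryProg-run : ∀ b d t u → ∃[ w ] ∃[ v ]
  All (_≢ marker) w × w ++ v ≡ map inj₁ (digits (Binary.suc b)) ++ inj₁ comma ∷ d
  × length w ≤ length (digits b)
  × carryProg ⊢ (map inj₁ (digits b) ++ inj₁ comma ∷ d) ∷ t ∷ u ∷ []
    ⇓[ 10 * length (digits b) + 10 ] v ∷ (w ʳ++ t) ∷ u ∷ []
carryProg-run ℕᵇ.zero d t u = [] , _ , [] , refl , z≤n ,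
  weaken (m≤m+n 4 6) (while-false refl ⨾ ifte-false refl push)
carryProg-run 1+[2 b ] d t u = [] , _ , [] , refl , z≤n ,
  weaken (≤-trans (m≤m+n 5 5) (m≤n+m 10 (10 * suc (length (digits b))))) (while-false refl ⨾ ifte-true refl (pop ⨾ push))
carryProg-run 2[1+ b ] d t u with carryProg-run b d (inj₁ one ∷ t) u
... | w , v , w≢ , eq , w≤ , run₁ = inj₁ one ∷ w , v , (λ ()) ∷ w≢ , cong (inj₁ one ∷_) eq , s≤s w≤ ,
  weaken (cost (length (digits b))) (while-⨾-true refl (pop ⨾ push) run₁)
  where
  cost : ∀ n → suc (3 + (10 * n + 10)) ≤ 10 * suc n + 10
  cost n = ≤-trans (m≤m+n _ 6) (≤-reflexive (arith n))
    where
    arith : ∀ n → suc (3 + (10 * n + 10)) + 6 ≡ 10 * suc n + 10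
    arith = solve-∀

fromℕ-suc : ∀ n → fromℕ (suc n) ≡ Binary.suc (fromℕ n)
fromℕ-suc n = trans (Binary.fromℕ≡fromℕ' (suc n)) (cong Binary.suc (sym (Binary.fromℕ≡fromℕ' n)))

suc-PolyTime : PolyTime nat nat suc
suc-PolyTime = record
  { prog = push 1F marker ⨾ carryProg ⨾ unload 1F 0F
  ; time = con 2 ⊕ (linear ⊕ linear)
  ; run  = sucRun
  }
  where
  sucRun : ∀ n d t u → (push 1F marker ⨾ carryProg ⨾ unload 1F 0F) ⊢ (enc nat n ++ d) ∷ t ∷ u ∷ []
    ⇓[ eval (con 2 ⊕ (linear ⊕ linear)) (size nat n) ] (enc nat (suc n) ++ d) ∷ t ∷ u ∷ []
  sucRun n d t u with carryProg-run (fromℕ n) d (marker ∷ t) u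
  ... | w , v , w≢ , eq , w≤ , run₁ =
    restart (cong (λ v → v ∷ t ∷ u ∷ []) (sym (nat-enc n d)))
    (retarget (cong (λ v → v ∷ t ∷ u ∷ []) (trans eq (trans
       (cong (λ b → map inj₁ (digits b) ++ inj₁ comma ∷ d) (sym (fromℕ-suc n))) (sym (nat-enc (suc n) d)))))
    (push ⨾ weaken (eval-mono linear digits≤) run₁
          ⨾ weaken (eval-mono linear (≤-trans w≤ digits≤)) (unload₁₀-run v t u w≢)))
    where
    digits≤ : length (digits (fromℕ n)) ≤ size nat n
    digits≤ = ≤-trans (≤-reflexive (sym (List.length-map inj₁ (digits (fromℕ n))))) (digitSyms≤size n)

-- The bound by `outSize` would let a counter grow by a factor at each increment; a fold needs this
-- additive one.
size-suc : ∀ n → size nat (suc n) ≤ suc (size nat n)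
size-suc n = begin
  size nat (suc n)                                       ≡⟨ size-nat (suc n) ⟩
  length (digits (fromℕ (suc n))) + 1                    ≡⟨ cong (λ b → length (digits b) + 1) (fromℕ-suc n) ⟩
  length (digits (Binary.suc (fromℕ n))) + 1             ≤⟨ +-monoˡ-≤ 1 (length-suc (fromℕ n)) ⟩
  suc (length (digits (fromℕ n)) + 1)                    ≡⟨ cong suc (size-nat n) ⟨
  suc (size nat n)                                       ∎
  where
  open ≤-Reasoning
  size-nat : ∀ n → size nat n ≡ length (digits (fromℕ n)) + 1
  size-nat n = trans (List.length-++ (digitSyms n)) (cong (_+ 1) (List.length-map inj₁ (digits (fromℕ n))))
  length-suc : ∀ b → length (digits (Binary.suc b)) ≤ suc (length (digits b))
  length-suc ℕᵇ.zero  = ≤-refl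
  length-suc 1+[2 b ] = n≤1+n _
  length-suc 2[1+ b ] = s≤s (length-suc b)

-- Lists

module _ {a A} (e : Listable a A) where

  private
    L : Code
    L = list e

  size-∷ : ∀ x xs → size L (x ∷ xs) ≡ size A x + size L xs
  size-∷ x xs = trans (cong length (List.++-assoc (enc A x) (concatMap (enc A) xs) [ a ]))
                      (List.length-++ (enc A x))

  enc-∷ : ∀ x xs → enc L (x ∷ xs) ≡ enc A x ++ enc L xs
  enc-∷ x xs = List.++-assoc (enc A x) (concatMap (enc A) xs) [ a ]

  length≤size : ∀ xs → length xs ≤ size L xs
  length≤size []       = z≤n
  length≤size (x ∷ xs) = ≤-trans (+-mono-≤ (1≤size x) (length≤size xs)) (≤-reflexive (sym (size-∷ x xs)))
    where
    1≤size : ∀ x → 1 ≤ size A x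
    1≤size x with nonempty e x
    ... | b , w , eq = ≤-trans (s≤s z≤n) (≤-reflexive (cong length (sym eq)))

  -- Concatenation saves one of the two terminators, hence the 1.
  size-++ : ∀ xs ys → size L (xs ++ ys) + 1 ≡ size L xs + size L ys
  size-++ []       ys = +-comm (size L ys) 1
  size-++ (x ∷ xs) ys = begin
    size L (x ∷ xs ++ ys) + 1              ≡⟨ cong (_+ 1) (size-∷ x (xs ++ ys)) ⟩
    size A x + size L (xs ++ ys) + 1       ≡⟨ +-assoc (size A x) _ 1 ⟩
    size A x + (size L (xs ++ ys) + 1)     ≡⟨ cong (size A x +_) (size-++ xs ys) ⟩
    size A x + (size L xs + size L ys)     ≡⟨ +-assoc (size A x) _ _ ⟨
    size A x + size L xs + size L ys       ≡⟨ cong (_+ size L ys) (size-∷ x xs) ⟨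
    size L (x ∷ xs) + size L ys            ∎
    where open ≡-Reasoning

  1≤sizeL : ∀ xs → 1 ≤ size L xs
  1≤sizeL xs = ≤-trans (m≤n+m 1 _) (≤-reflexive (sym (List.length-++ (concatMap (enc A) xs))))

  size-prefix : ∀ xs ys → size L xs ≤ size L (xs ++ ys)
  size-prefix xs ys = +-cancelʳ-≤ 1 (size L xs) (size L (xs ++ ys))
    (≤-trans (+-monoʳ-≤ (size L xs) (1≤sizeL ys)) (≤-reflexive (sym (size-++ xs ys))))

  -- The encoding of x ∷ xs is that of the pair x , xs.
  cons-PolyTime : {x : Carrier Γ → Carrier A} {xs : Carrier Γ → List (Carrier A)} →
                  PolyTime Γ A x → PolyTime Γ L xs → PolyTime Γ L (λ γ → x γ ∷ xs γ)
  cons-PolyTime X XS = consing ∘ᵖ ⟪ X , XS ⟫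
    where
    consing : PolyTime (A ⊗ᶜ L) L (λ (x , xs) → x ∷ xs)
    consing = record
      { prog = skip
      ; time = con 1
      ; run  = λ (x , xs) d t u →
          retarget (cong (λ w → (w ++ d) ∷ t ∷ u ∷ []) (sym (enc-∷ x xs))) skip
      }

  module _ {step : Carrier (A ⊗ᶜ S) → Carrier S} (F : PolyTime (A ⊗ᶜ S) S step) (q : Poly)
           (bound : ∀ xs z → size S (foldl (λ z x → step (x , z)) z xs) ≤ eval q (size L xs + size S z)) where

    private
      result : Carrier S → List (Carrier A) → Carrier S
      result = foldl (λ z x → step (x , z))

      body : PolyTime (A ⊗ᶜ (L ⊗ᶜ S)) (L ⊗ᶜ S) (λ (x , xs , z) → xs , step (x , z))
      body = ⟪ π₁ ∘ᵖ π₂ {A} , F ∘ᵖ ⟪ π₁ , π₂ {L} ∘ᵖ π₂ {A} ⟫ ⟫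

      -- `N` bounds the remaining list and `M` the accumulator after each prefix, so that all
      -- iterations have the same cost bound.
      loop : ∀ {N M} xs z d t u → size L xs ≤ N →
             (∀ ys zs → xs ≡ ys ++ zs → size S (result z ys) ≤ M) →
             while (isNotTop 0F a) (prog body) ⊢ ((enc L xs ++ enc S z) ++ d) ∷ t ∷ u ∷ []
             ⇓[ length xs * suc (eval (time body) (N + M)) + 1 ]
             (a ∷ enc S (result z xs) ++ d) ∷ t ∷ u ∷ []
      loop [] z d t u xs≤N bound = while-false (cong not (isSym-refl a))
      loop {N} {M} (x ∷ xs) z d t u xs≤N bound =
        weaken (≤-reflexive (cong suc (sym (+-assoc c (length xs * suc c) 1))))
        (while-true nonempty-top
          -- As words, the encodings of `x ∷ xs , z` and of `x , xs , z` coincide, so the body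
          -- applies without any unpacking.
          (restart (sym rearrange) (weaken (eval-mono (time body) size≤) (run body (x , xs , z) d t u)))
          (loop xs (step (x , z)) d t u
            (≤-trans (≤-trans (m≤n+m _ (size A x)) (≤-reflexive (sym (size-∷ x xs)))) xs≤N)
            (λ ys zs eq → bound (x ∷ ys) zs (cong (x ∷_) eq))))
        where
        c = eval (time body) (N + M)
        open ≡-Reasoning
        rearrange′ : (enc L (x ∷ xs) ++ enc S z) ++ d ≡ (enc A x ++ enc L xs ++ enc S z) ++ d
        rearrange′ = cong (_++ d) (trans (cong (_++ enc S z) (enc-∷ x xs)) (List.++-assoc (enc A x) _ _))
        rearrange : _≡_ {A = Stacks} (((enc L (x ∷ xs) ++ enc S z) ++ d) ∷ t ∷ u ∷ [])
                                     (((enc A x ++ enc L xs ++ enc S z) ++ d) ∷ t ∷ u ∷ [])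
        rearrange = cong (λ v → v ∷ t ∷ u ∷ []) rearrange′
        size≤ : size (A ⊗ᶜ (L ⊗ᶜ S)) (x , xs , z) ≤ N + M
        size≤ = ≤-trans (≤-reflexive (begin
          size (A ⊗ᶜ (L ⊗ᶜ S)) (x , xs , z)         ≡⟨ size-⊗ A (L ⊗ᶜ S) x (xs , z) ⟩
          size A x + size (L ⊗ᶜ S) (xs , z)         ≡⟨ cong (size A x +_) (size-⊗ L S xs z) ⟩
          size A x + (size L xs + size S z)         ≡⟨ +-assoc (size A x) _ _ ⟨
          size A x + size L xs + size S z           ≡⟨ cong (_+ size S z) (size-∷ x xs) ⟨
          size L (x ∷ xs) + size S z                ∎))
          (+-mono-≤ xs≤N (bound [] (x ∷ xs) refl))
        nonempty-top : isNotTop 0F a (tops (((enc L (x ∷ xs) ++ enc S z) ++ d) ∷ t ∷ u ∷ [])) ≡ true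
        nonempty-top with nonempty e x | avoids e x
        ... | b , w , eq | all = trans
          (cong (λ w → not (isSym a (head w))) (trans rearrange′ (cong (λ v → (v ++ enc L xs ++ enc S z) ++ d) eq)))
          (cong not (isSym-≢ (All.head (subst (All (_≢ a)) eq all))))

    foldl-PolyTime : PolyTime (L ⊗ᶜ S) S (λ (xs , z) → foldl (λ z x → step (x , z)) z xs)
    foldl-PolyTime = record
      -- An exhausted list has left only its terminator above the accumulator, and `pop` removes it.
      { prog = while (isNotTop 0F a) (prog body) ⨾ pop 0F
      ; time = var ⊗ (con 1 ⊕ time body ⟨ var ⊕ q ⟩) ⊕ con 1 ⊕ con 1
      ; run  = λ (xs , z) d t u → weaken (+-monoˡ-≤ 1 (+-monoˡ-≤ 1
          (*-mono-≤ (≤-trans (length≤size xs) (size-fst L S xs z))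
                    (s≤s (≤-reflexive (sym (eval-⟨⟩ (time body) (var ⊕ q) (size (L ⊗ᶜ S) (xs , z)))))))))
          (loop xs z d t u (size-fst L S xs z) (prefix-bound xs z) ⨾ pop)
      }
      where
      -- An intermediate accumulator is the result of folding a prefix, which is no larger than the
      -- list, so the bound on results covers it.
      prefix-bound : ∀ xs z ys zs → xs ≡ ys ++ zs →
                     size S (result z ys) ≤ eval q (size (L ⊗ᶜ S) (xs , z))
      prefix-bound _ z ys zs refl = ≤-trans (bound ys z) (eval-mono q
        (≤-trans (+-monoˡ-≤ (size S z) (size-prefix ys zs)) (≤-reflexive (sym (size-⊗ L S (ys ++ zs) z)))))

reverse-PolyTime : ∀ {a A} (e : Listable a A) → PolyTime (list e) (list e) reverse
reverse-PolyTime {A = A} e =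
  foldl-PolyTime e (cons-PolyTime e π₁ (π₂ {A})) var bound ∘ᵖ ⟪ id-PolyTime , const-PolyTime [] ⟫
  where
  bound : ∀ xs ys → size (list e) (foldl (λ ys x → x ∷ ys) ys xs) ≤ size (list e) xs + size (list e) ys
  bound []       ys = m≤n+m _ 1
  bound (x ∷ xs) ys = ≤-trans (bound xs (x ∷ ys)) (≤-reflexive
    (trans (cong (size (list e) xs +_) (size-∷ e x ys))
    (trans (lemma (size (list e) xs) (size A x) (size (list e) ys))
    (cong (_+ size (list e) ys) (sym (size-∷ e x xs))))))
    where
    lemma : ∀ l m n → l + (m + n) ≡ m + l + n
    lemma = solve-∀

module _ {a A} (e : Listable a A) {f : Carrier (A ⊗ᶜ (S ⊗ᶜ Γ)) → Carrier S} where

  private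
    L : Code
    L = list e

    folded : Carrier Γ → Carrier S → List (Carrier A) → Carrier S
    folded γ = foldr (λ x z → f (x , z , γ))

  -- A step of `foldl-PolyTime` sees only the element and the accumulator, so the context travels
  -- inside the accumulator; reversing the list turns the left fold into a right one.
  foldr-PolyTime : PolyTime (A ⊗ᶜ (S ⊗ᶜ Γ)) S f → (q : Poly) →
    (∀ γ z xs → size S (folded γ z xs) ≤ eval q (size L xs + size S z + size Γ γ)) →
    {xs : Carrier Γ → List (Carrier A)} {z : Carrier Γ → Carrier S} →
    PolyTime Γ L xs → PolyTime Γ S z → PolyTime Γ S (λ γ → folded γ (z γ) (xs γ))
  foldr-PolyTime F q bound {xs} {z} XS Z =
    ext-PolyTime (λ γ → trans (cong proj₁ (foldl-pair γ (z γ) (reverse (xs γ))))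
                              (List.reverse-foldl (λ z x → f (x , z , γ)) (z γ) (xs γ)))
      (π₁ ∘ᵖ foldl-PolyTime e ⟪ F , π₂ {S} ∘ᵖ π₂ {A} ⟫ (q ⊕ var) bound′ ∘ᵖ
       ⟪ reverse-PolyTime e ∘ᵖ XS , ⟪ Z , id-PolyTime ⟫ ⟫)
    where
    step : Carrier S × Carrier Γ → Carrier A → Carrier S × Carrier Γ
    step (z , γ) x = f (x , z , γ) , γ
    foldl-pair : ∀ γ z xs → foldl step (z , γ) xs ≡ (foldl (λ z x → f (x , z , γ)) z xs , γ)
    foldl-pair γ z []       = refl
    foldl-pair γ z (x ∷ xs) = foldl-pair γ (f (x , z , γ)) xs
    size-reverse : ∀ xs → size L (reverse xs) ≡ size L xs
    size-reverse []       = refl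
    size-reverse (x ∷ xs) = +-cancelʳ-≡ 1 _ _ (begin
      size L (reverse (x ∷ xs)) + 1               ≡⟨ cong (λ ys → size L ys + 1) (List.unfold-reverse x xs) ⟩
      size L (reverse xs ++ [ x ]) + 1            ≡⟨ size-++ e (reverse xs) [ x ] ⟩
      size L (reverse xs) + size L [ x ]          ≡⟨ cong₂ _+_ (size-reverse xs) (size-∷ e x []) ⟩
      size L xs + (size A x + 1)                  ≡⟨ lemma (size L xs) (size A x) ⟩
      size A x + size L xs + 1                    ≡⟨ cong (_+ 1) (size-∷ e x xs) ⟨
      size L (x ∷ xs) + 1                         ∎)
      where
      open ≡-Reasoning
      lemma : ∀ m n → m + (n + 1) ≡ n + m + 1
      lemma = solve-∀
    bound′ : ∀ xs zγ → size (S ⊗ᶜ Γ) (foldl step zγ xs) ≤ eval (q ⊕ var) (size L xs + size (S ⊗ᶜ Γ) zγ)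
    bound′ xs (z , γ) = begin
      size (S ⊗ᶜ Γ) (foldl step (z , γ) xs)
        ≡⟨ cong (size (S ⊗ᶜ Γ)) (foldl-pair γ z xs) ⟩
      size (S ⊗ᶜ Γ) (foldl (λ z x → f (x , z , γ)) z xs , γ)
        ≡⟨ size-⊗ S Γ _ γ ⟩
      size S (foldl (λ z x → f (x , z , γ)) z xs) + size Γ γ
        ≡⟨ cong (λ y → size S y + size Γ γ) unreverse ⟩
      size S (folded γ z (reverse xs)) + size Γ γ
        ≤⟨ +-mono-≤ (bound γ z (reverse xs)) (m≤n+m (size Γ γ) (size L xs + size S z)) ⟩
      eval q (size L (reverse xs) + size S z + size Γ γ) + (size L xs + size S z + size Γ γ)
        ≡⟨ cong (λ n → eval q (n + size S z + size Γ γ) + (size L xs + size S z + size Γ γ)) (size-reverse xs) ⟩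
      eval (q ⊕ var) (size L xs + size S z + size Γ γ)
        ≡⟨ cong (eval (q ⊕ var)) (trans (+-assoc (size L xs) _ _) (cong (size L xs +_) (sym (size-⊗ S Γ z γ)))) ⟩
      eval (q ⊕ var) (size L xs + size (S ⊗ᶜ Γ) (z , γ))
        ∎
      where
      open ≤-Reasoning
      unreverse : foldl (λ z x → f (x , z , γ)) z xs ≡ folded γ z (reverse xs)
      unreverse = trans (cong (foldl _ z) (sym (List.reverse-involutive xs)))
                        (List.reverse-foldl (λ z x → f (x , z , γ)) z (reverse xs))

  -- If the growth per step does not depend on the accumulator, it adds up over the list instead of
  -- compounding.
  foldr⁺-PolyTime : PolyTime (A ⊗ᶜ (S ⊗ᶜ Γ)) S f → (p : Poly) →
    (∀ x z γ → size S (f (x , z , γ)) ≤ size S z + eval p (size A x + size Γ γ)) →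
    {xs : Carrier Γ → List (Carrier A)} {z : Carrier Γ → Carrier S} →
    PolyTime Γ L xs → PolyTime Γ S z → PolyTime Γ S (λ γ → folded γ (z γ) (xs γ))
  foldr⁺-PolyTime F p growth = foldr-PolyTime F (var ⊕ var ⊗ p) bound
    where
    bound′ : ∀ {n} γ z xs → size L xs + size Γ γ ≤ n →
             size S (folded γ z xs) ≤ size S z + length xs * eval p n
    bound′ γ z []       ≤n = m≤m+n _ 0
    bound′ {n} γ z (x ∷ xs) ≤n = begin
      size S (folded γ z (x ∷ xs))                               ≤⟨ growth x _ γ ⟩
      size S (folded γ z xs) + eval p (size A x + size Γ γ)      ≤⟨ +-mono-≤ (bound′ γ z xs xs≤n) (eval-mono p x≤n) ⟩
      size S z + length xs * eval p n + eval p n                 ≡⟨ lemma (size S z) (length xs) (eval p n) ⟩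
      size S z + suc (length xs) * eval p n                      ∎
      where
      open ≤-Reasoning
      lemma : ∀ a b c → a + b * c + c ≡ a + suc b * c
      lemma = solve-∀
      xs≤n : size L xs + size Γ γ ≤ n
      xs≤n = ≤-trans (+-monoˡ-≤ (size Γ γ) (≤-trans (m≤n+m _ (size A x)) (≤-reflexive (sym (size-∷ e x xs))))) ≤n
      x≤n : size A x + size Γ γ ≤ n
      x≤n = ≤-trans (+-monoˡ-≤ (size Γ γ) (≤-trans (m≤m+n (size A x) _) (≤-reflexive (sym (size-∷ e x xs))))) ≤n
    bound : ∀ γ z xs → size S (folded γ z xs) ≤ eval (var ⊕ var ⊗ p) (size L xs + size S z + size Γ γ)
    bound γ z xs = ≤-trans (bound′ γ z xs (+-monoˡ-≤ (size Γ γ) (m≤m+n (size L xs) (size S z))))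
      (+-mono-≤ (≤-trans (m≤n+m (size S z) (size L xs)) (m≤m+n _ (size Γ γ)))
                (*-monoˡ-≤ (eval p (size L xs + size S z + size Γ γ))
                  (≤-trans (length≤size e xs) (≤-trans (m≤m+n (size L xs) (size S z)) (m≤m+n _ (size Γ γ))))))

-- The algorithm

-- `foldr` treats the tail first, so the replacements are replayed in the order in which they were
-- made, with `w` starting as its own label.
find : List (ℕ × ℕ) → ℕ → ℕ
find M w = foldr (λ m x → if x ≡ᵇ proj₁ m then proj₂ m else x) w M

-- M is a list of label replacements, the most recent one first: vertices u
-- and v are known to be connected if find M u ≡ find M v.
merge : ℕ → ℕ × ℕ × ℕ → List (ℕ × ℕ) → List (ℕ × ℕ)
merge i (u , v , c) M = if c ≡ᵇ i then M else ((find M u , find M v) ∷ M)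

merges : ℕ → List (ℕ × ℕ × ℕ) → List (ℕ × ℕ)
merges i = foldr (merge i) []

connected : List ℕ → List (ℕ × ℕ × ℕ) → ℕ → ℕ → Bool
connected C E v w =
  foldr (λ i b → if b then find (merges i E) v ≡ᵇ find (merges i E) w else false) true C

component : List ℕ → List ℕ → List (ℕ × ℕ × ℕ) → ℕ → List ℕ
component V C E v = foldr (λ w R → if connected C E v w then w ∷ R else R) [] V

-- The head of the list, written as a fold to fit the closure properties. A component contains its
-- own vertex, so there is a head.
leader : List ℕ → ℕ
leader = foldr (λ x _ → x) 0

components : List ℕ → List ℕ → List (ℕ × ℕ × ℕ) → List (List ℕ)
components V C E =
  foldr (λ v Rs → if leader (component V C E v) ≡ᵇ v then component V C E v ∷ Rs else Rs) [] V

-- Numbers can only be incremented and tested for equality, so the flag records that the count has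
-- once been `l`; for positive `l` this means at least `l` elements. The loop runs over the list and
-- not up to `l`, which may be exponential in the length of its encoding.
count : ℕ → List ℕ → ℕ × Bool
count l = foldr (λ _ nb → suc (proj₁ nb) , (if proj₂ nb then true else suc (proj₁ nb) ≡ᵇ l)) (0 , false)

anyLarge : List ℕ → List ℕ → List (ℕ × ℕ × ℕ) → ℕ → Bool
anyLarge V C E l = foldr (λ v b → if b then true else proj₂ (count l (component V C E v))) false V

-- Codes of the data of the algorithm

nat-listable : ∀ {a} → inj₁ one ≢ a → inj₁ two ≢ a → inj₁ comma ≢ a → a ≢ marker → Listable a nat
nat-listable 1≢ 2≢ ,≢ a≢mark = record
  { a≢mark   = a≢mark
  ; nonempty = λ n → ++-nonempty (digitSyms n)
  ; avoids   = λ n → All.++⁺ (digits-avoid 1≢ 2≢ (fromℕ n)) (,≢ ∷ [])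
  }
  where
  ++-nonempty : ∀ w {a} → ∃[ b ] ∃[ v ] w ++ [ a ] ≡ b ∷ v
  ++-nonempty []      = _ , _ , refl
  ++-nonempty (b ∷ w) = _ , _ , refl

⊗-listable : ∀ {a} → Listable a A → Listable a B → Listable a (A ⊗ᶜ B)
⊗-listable {A} {B} e f = record
  { a≢mark   = a≢mark e
  ; nonempty = λ (x , y) → let b , w , eq = nonempty e x in b , w ++ enc B y , cong (_++ enc B y) eq
  ; avoids   = λ (x , y) → All.++⁺ (avoids e x) (avoids f y)
  }

list-listable : ∀ {a b} (e : Listable b A) → Listable a A → b ≢ a → Listable a (list e)
list-listable {A} {a} {b} e f b≢a = record
  { a≢mark   = a≢mark f
  ; nonempty = λ
      { []       → _ , _ , refl
      ; (x ∷ xs) → let b , w , eq = nonempty f x in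
          b , _ , cong (λ v → (v ++ concatMap (enc A) xs) ++ _) eq }
  ; avoids   = λ xs → All.++⁺ (avoids* xs) (b≢a ∷ [])
  }
  where
  avoids* : ∀ xs → All (_≢ a) (concatMap (enc A) xs)
  avoids* []       = []
  avoids* (x ∷ xs) = All.++⁺ (avoids f x) (avoids* xs)

natˢ : Listable (inj₁ semicolon) nat
natˢ = nat-listable (λ ()) (λ ()) (λ ()) (λ ())

pairˢ : Listable (inj₁ semicolon) (nat ⊗ᶜ nat)
pairˢ = ⊗-listable natˢ natˢ

edgeˢ : Listable (inj₁ semicolon) (nat ⊗ᶜ nat ⊗ᶜ nat)
edgeˢ = ⊗-listable natˢ pairˢ

nats pairs edges : Code
nats  = list natˢ
pairs = list pairˢ
edges = list edgeˢ

-- The outer list needs a terminator other than the inner semicolon. With `end`, the word in front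
-- of it is exactly the output encoding of the statement.
natsᵉ : Listable (inj₂ end) nats
natsᵉ = list-listable natˢ (nat-listable (λ ()) (λ ()) (λ ()) (λ ())) (λ ())

natLists : Code
natLists = list natsᵉ

-- Running time of the algorithm

size-if : ∀ A b {x y n} → size A x ≤ n → size A y ≤ n → size A (if b then x else y) ≤ n
size-if A true  x≤ y≤ = x≤
size-if A false x≤ y≤ = y≤

equal-of : {x y : Carrier Γ → ℕ} → PolyTime Γ nat x → PolyTime Γ nat y → PolyTime Γ bool (λ γ → x γ ≡ᵇ y γ)
equal-of X Y = equal-PolyTime ∘ᵖ ⟪ X , Y ⟫

find-PolyTime : {M : Carrier Γ → List (ℕ × ℕ)} {w : Carrier Γ → ℕ} →
                PolyTime Γ pairs M → PolyTime Γ nat w → PolyTime Γ nat (λ γ → find (M γ) (w γ))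
find-PolyTime {Γ} = foldr⁺-PolyTime pairˢ
  (if-PolyTime (equal-of (π₁ ∘ᵖ π₂ {nat ⊗ᶜ nat}) (π₁ {nat} {nat} ∘ᵖ π₁))
               (π₂ {nat} {nat} ∘ᵖ π₁) (π₁ ∘ᵖ π₂ {nat ⊗ᶜ nat}))
  var
  (λ (a , b) x γ → size-if nat (x ≡ᵇ a)
    (≤-trans (≤-trans (size-snd nat nat a b) (m≤m+n _ (size Γ γ))) (m≤n+m _ (size nat x)))
    (m≤m+n (size nat x) _))

-- Bounding second components suffices: `find` returns one of them or its argument.
Bounded : ℕ → List (ℕ × ℕ) → Set
Bounded n = All (λ m → size nat (proj₂ m) ≤ n)

find-bounded : ∀ {n M w} → Bounded n M → size nat w ≤ n → size nat (find M w) ≤ n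
find-bounded []       w≤ = w≤
find-bounded {M = m ∷ M} {w} (m≤ ∷ M≤) w≤ = size-if nat (find M w ≡ᵇ proj₁ m) m≤ (find-bounded M≤ w≤)

size⇒Bounded : ∀ {n} M → size pairs M ≤ n → Bounded n M
size⇒Bounded []            M≤ = []
size⇒Bounded ((a , b) ∷ M) M≤ =
  ≤-trans (size-snd nat nat a b) (≤-trans (m≤m+n _ (size pairs M)) ≤n) ∷
  size⇒Bounded M (≤-trans (m≤n+m _ (size (nat ⊗ᶜ nat) (a , b))) ≤n)
  where
  ≤n = ≤-trans (≤-reflexive (sym (size-∷ pairˢ (a , b) M))) M≤

merge-bounded : ∀ {n i e M} → size (nat ⊗ᶜ nat ⊗ᶜ nat) e ≤ n → Bounded n M →
                Bounded n (merge i e M) × size pairs (merge i e M) ≤ size pairs M + (n + n)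
merge-bounded {n} {i} {u , v , c} {M} e≤ M≤ with c ≡ᵇ i
... | true  = M≤ , m≤m+n _ _
... | false = v≤ ∷ M≤ , (begin
  size pairs ((find M u , find M v) ∷ M)                        ≡⟨ size-∷ pairˢ (find M u , find M v) M ⟩
  size (nat ⊗ᶜ nat) (find M u , find M v) + size pairs M        ≡⟨ +-comm (size (nat ⊗ᶜ nat) (find M u , find M v)) (size pairs M) ⟩
  size pairs M + size (nat ⊗ᶜ nat) (find M u , find M v)        ≡⟨ cong (size pairs M +_) (size-⊗ nat nat (find M u) (find M v)) ⟩
  size pairs M + (size nat (find M u) + size nat (find M v))    ≤⟨ +-monoʳ-≤ (size pairs M) (+-mono-≤ u≤ v≤) ⟩
  size pairs M + (n + n)                                        ∎)
  where
  open ≤-Reasoning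
  u≤ : size nat (find M u) ≤ n
  u≤ = find-bounded M≤ (≤-trans (size-fst nat (nat ⊗ᶜ nat) u (v , c)) e≤)
  v≤ : size nat (find M v) ≤ n
  v≤ = find-bounded M≤ (≤-trans (size-fst nat nat v c) (≤-trans (size-snd nat (nat ⊗ᶜ nat) u (v , c)) e≤))

-- A label is always a vertex of the input, so that it cannot grow in the
-- course of the relabellings.
merges-bounded : ∀ {n i M} es → size edges es ≤ n → Bounded n M →
                 Bounded n (foldr (merge i) M es) ×
                 size pairs (foldr (merge i) M es) ≤ size pairs M + length es * (n + n)
merges-bounded {n} {i} {M} []       es≤ M≤ = M≤ , m≤m+n _ 0
merges-bounded {n} {i} {M} (e ∷ es) es≤ M≤ =
  let split = ≤-trans (≤-reflexive (sym (size-∷ edgeˢ e es))) es≤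
      all≤ , fold≤ = merges-bounded {i = i} {M} es (≤-trans (m≤n+m _ (size (nat ⊗ᶜ nat ⊗ᶜ nat) e)) split) M≤
      all≤′ , step≤ = merge-bounded {n} {i} {e} (≤-trans (m≤m+n _ (size edges es)) split) all≤
  in all≤′ , ≤-trans step≤ (≤-trans (+-monoˡ-≤ (n + n) fold≤)
       (≤-reflexive (lemma (size pairs M) (length es) (n + n))))
  where
  lemma : ∀ a b c → a + b * c + c ≡ a + suc b * c
  lemma = solve-∀

-- The labels in a new entry may come from `M`, so the growth of a step is not bounded by the edge
-- and the context alone, as `foldr⁺-PolyTime` would require. Instead `merges-bounded` provides the
-- invariant that each edge adds at most two labels of size `n`.
merges-PolyTime : {i : Carrier Γ → ℕ} {E : Carrier Γ → List (ℕ × ℕ × ℕ)} →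
                  PolyTime Γ nat i → PolyTime Γ edges E → PolyTime Γ pairs (λ γ → merges (i γ) (E γ))
merges-PolyTime I E = merging ∘ᵖ ⟪ I , E ⟫
  where
  edge context : Code
  edge    = nat ⊗ᶜ nat ⊗ᶜ nat
  context = nat ⊗ᶜ edges
  M : PolyTime (edge ⊗ᶜ pairs ⊗ᶜ context) pairs (λ x → proj₁ (proj₂ x))
  M = π₁ ∘ᵖ π₂ {edge}
  step : PolyTime (edge ⊗ᶜ pairs ⊗ᶜ context) pairs (λ (e , M , i , _) → merge i e M)
  step = if-PolyTime
    (equal-of (π₂ {nat} ∘ᵖ π₂ {nat} ∘ᵖ π₁ {edge}) (π₁ {nat} {edges} ∘ᵖ π₂ {pairs} ∘ᵖ π₂ {edge}))
    M
    (cons-PolyTime pairˢ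
      ⟪ find-PolyTime M (π₁ {nat} {nat ⊗ᶜ nat} ∘ᵖ π₁) , find-PolyTime M (π₁ {nat} {nat} ∘ᵖ π₂ {nat} ∘ᵖ π₁) ⟫
      M)
  bound : ∀ γ M es → size pairs (foldr (merge (proj₁ γ)) M es) ≤
                     eval (var ⊕ var ⊗ (var ⊕ var)) (size edges es + size pairs M + size context γ)
  bound γ M es = ≤-trans (proj₂ (merges-bounded {n = n} {proj₁ γ} es es≤ (size⇒Bounded M M≤)))
    (+-mono-≤ M≤ (*-monoˡ-≤ (n + n) (≤-trans (length≤size edgeˢ es) es≤)))
    where
    n = size edges es + size pairs M + size context γ
    es≤ : size edges es ≤ n
    es≤ = ≤-trans (m≤m+n _ (size pairs M)) (m≤m+n _ (size context γ))
    M≤ : size pairs M ≤ n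
    M≤ = ≤-trans (m≤n+m _ (size edges es)) (m≤m+n _ (size context γ))
  merging : PolyTime context pairs (λ (i , E) → merges i E)
  merging = foldr-PolyTime edgeˢ step (var ⊕ var ⊗ (var ⊕ var)) bound π₂ (const-PolyTime [])

connected-PolyTime : {C : Carrier Γ → List ℕ} {E : Carrier Γ → List (ℕ × ℕ × ℕ)} {v w : Carrier Γ → ℕ} →
  PolyTime Γ nats C → PolyTime Γ edges E → PolyTime Γ nat v → PolyTime Γ nat w →
  PolyTime Γ bool (λ γ → connected (C γ) (E γ) (v γ) (w γ))
connected-PolyTime {Γ} {E = Es} C E V W = foldr⁺-PolyTime natˢ
  (if-PolyTime (π₁ ∘ᵖ π₂ {nat}) (equal-of (find-PolyTime M (lift V)) (find-PolyTime M (lift W)))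
               (const-PolyTime false))
  -- A Boolean always occupies one symbol, so the accumulator does not grow.
  (con 0) (λ _ _ _ → s≤s z≤n) C (const-PolyTime true)
  where
  lift : ∀ {A f} → PolyTime Γ A f → PolyTime (nat ⊗ᶜ bool ⊗ᶜ Γ) A (λ x → f (proj₂ (proj₂ x)))
  lift F = F ∘ᵖ π₂ {bool} ∘ᵖ π₂ {nat}
  M : PolyTime (nat ⊗ᶜ bool ⊗ᶜ Γ) pairs (λ x → merges (proj₁ x) (Es (proj₂ (proj₂ x))))
  M = merges-PolyTime π₁ (lift E)

component-PolyTime :
  {V C : Carrier Γ → List ℕ} {E : Carrier Γ → List (ℕ × ℕ × ℕ)} {v : Carrier Γ → ℕ} →
  PolyTime Γ nats V → PolyTime Γ nats C → PolyTime Γ edges E → PolyTime Γ nat v →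
  PolyTime Γ nats (λ γ → component (V γ) (C γ) (E γ) (v γ))
component-PolyTime {Γ} {V} {C} {E} {v} Vᵖ Cᵖ Eᵖ vᵖ = foldr⁺-PolyTime natˢ
  (if-PolyTime (connected-PolyTime (lift Cᵖ) (lift Eᵖ) (lift vᵖ) π₁) (cons-PolyTime natˢ π₁ R) R)
  var
  (λ w R γ → size-if nats (connected (C γ) (E γ) (v γ) w)
    (≤-trans (≤-reflexive (trans (size-∷ natˢ w R) (+-comm (size nat w) (size nats R))))
             (+-monoʳ-≤ (size nats R) (m≤m+n (size nat w) (size Γ γ))))
    (m≤m+n (size nats R) _))
  Vᵖ (const-PolyTime [])
  where
  lift : ∀ {A f} → PolyTime Γ A f → PolyTime (nat ⊗ᶜ nats ⊗ᶜ Γ) A (λ x → f (proj₂ (proj₂ x)))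
  lift F = F ∘ᵖ π₂ {nats} ∘ᵖ π₂ {nat}
  R : PolyTime (nat ⊗ᶜ nats ⊗ᶜ Γ) nats (λ x → proj₁ (proj₂ x))
  R = π₁ ∘ᵖ π₂ {nat}

leader-PolyTime : PolyTime nats nat leader
leader-PolyTime = foldr⁺-PolyTime {Γ = nats} natˢ π₁ var
  (λ x z γ → ≤-trans (m≤m+n (size nat x) (size nats γ)) (m≤n+m _ (size nat z)))
  id-PolyTime (const-PolyTime 0)

components-PolyTime : {V C : Carrier Γ → List ℕ} {E : Carrier Γ → List (ℕ × ℕ × ℕ)} →
  PolyTime Γ nats V → PolyTime Γ nats C → PolyTime Γ edges E →
  PolyTime Γ natLists (λ γ → components (V γ) (C γ) (E γ))
components-PolyTime {Γ} {V} {C} {E} Vᵖ Cᵖ Eᵖ = foldr⁺-PolyTime natˢ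
  (if-PolyTime (equal-of (leader-PolyTime ∘ᵖ R) π₁) (cons-PolyTime natsᵉ R (π₁ ∘ᵖ π₂ {nat})) (π₁ ∘ᵖ π₂ {nat}))
  -- The size of an added component is bounded in terms of the vertex and the context, whatever has
  -- been listed before.
  (outSize Comp)
  (λ v Rs γ → size-if natLists (leader (component (V γ) (C γ) (E γ) v) ≡ᵇ v)
    (≤-trans (≤-reflexive (trans (size-∷ natsᵉ (component (V γ) (C γ) (E γ) v) Rs) (+-comm _ (size natLists Rs))))
      (+-monoʳ-≤ (size natLists Rs) (≤-trans (size≤outSize Comp (v , γ))
        (≤-reflexive (cong (eval (outSize Comp)) (size-⊗ nat Γ v γ))))))
    (m≤m+n (size natLists Rs) _))
  Vᵖ (const-PolyTime [])
  where
  Comp : PolyTime (nat ⊗ᶜ Γ) nats (λ (v , γ) → component (V γ) (C γ) (E γ) v)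
  Comp = component-PolyTime (Vᵖ ∘ᵖ π₂ {nat}) (Cᵖ ∘ᵖ π₂ {nat}) (Eᵖ ∘ᵖ π₂ {nat}) π₁
  R : PolyTime (nat ⊗ᶜ natLists ⊗ᶜ Γ) nats
        (λ (v , _ , γ) → component (V γ) (C γ) (E γ) v)
  R = Comp ∘ᵖ ⟪ π₁ , π₂ {natLists} ∘ᵖ π₂ {nat} ⟫

count-PolyTime : {l : Carrier Γ → ℕ} {R : Carrier Γ → List ℕ} →
  PolyTime Γ nat l → PolyTime Γ nats R → PolyTime Γ bool (λ γ → proj₂ (count (l γ) (R γ)))
count-PolyTime {Γ} {l} L R = π₂ {nat} ∘ᵖ foldr⁺-PolyTime natˢ
  ⟪ next , if-PolyTime (π₂ {nat} ∘ᵖ π₁ ∘ᵖ π₂ {nat}) (const-PolyTime true)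
             (equal-of next (L ∘ᵖ π₂ {nat ⊗ᶜ bool} ∘ᵖ π₂ {nat})) ⟫
  (con 1)
  (λ { x (n , b) γ → growth n b _ })
  R (const-PolyTime (0 , false))
  where
  next : PolyTime (nat ⊗ᶜ (nat ⊗ᶜ bool) ⊗ᶜ Γ) nat (λ x → suc (proj₁ (proj₁ (proj₂ x))))
  next = suc-PolyTime ∘ᵖ π₁ {nat} {bool} ∘ᵖ π₁ ∘ᵖ π₂ {nat}
  growth : ∀ n b c → size (nat ⊗ᶜ bool) (suc n , c) ≤ size (nat ⊗ᶜ bool) (n , b) + 1
  growth n b c = begin
    size (nat ⊗ᶜ bool) (suc n , c)        ≡⟨ size-⊗ nat bool (suc n) c ⟩
    size nat (suc n) + 1                  ≤⟨ +-monoˡ-≤ 1 (size-suc n) ⟩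
    suc (size nat n) + 1                  ≡⟨ cong (_+ 1) (+-comm 1 (size nat n)) ⟩
    size nat n + 1 + 1                    ≡⟨ cong (_+ 1) (size-⊗ nat bool n b) ⟨
    size (nat ⊗ᶜ bool) (n , b) + 1        ∎
    where open ≤-Reasoning

anyLarge-PolyTime :
  {V C : Carrier Γ → List ℕ} {E : Carrier Γ → List (ℕ × ℕ × ℕ)} {l : Carrier Γ → ℕ} →
  PolyTime Γ nats V → PolyTime Γ nats C → PolyTime Γ edges E → PolyTime Γ nat l →
  PolyTime Γ bool (λ γ → anyLarge (V γ) (C γ) (E γ) (l γ))
anyLarge-PolyTime {Γ} Vᵖ Cᵖ Eᵖ lᵖ = foldr⁺-PolyTime natˢ
  (if-PolyTime (π₁ ∘ᵖ π₂ {nat}) (const-PolyTime true)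
    (count-PolyTime (lift lᵖ) (component-PolyTime (lift Vᵖ) (lift Cᵖ) (lift Eᵖ) π₁)))
  (con 0) (λ _ _ _ → s≤s z≤n) Vᵖ (const-PolyTime false)
  where
  lift : ∀ {A f} → PolyTime Γ A f → PolyTime (nat ⊗ᶜ bool ⊗ᶜ Γ) A (λ x → f (proj₂ (proj₂ x)))
  lift F = F ∘ᵖ π₂ {bool} ∘ᵖ π₂ {nat}

graphᶜ instanceᶜ : Code
graphᶜ    = nats ⊗ᶜ nats ⊗ᶜ edges
instanceᶜ = nats ⊗ᶜ nats ⊗ᶜ edges ⊗ᶜ nat

search : PolyTime graphᶜ natLists (λ (V , C , E) → components V C E)
search = components-PolyTime π₁ (π₁ ∘ᵖ π₂ {nats}) (π₂ {nats} ∘ᵖ π₂ {nats})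

decide : PolyTime instanceᶜ bool (λ (V , C , E , l) → anyLarge V C E l)
decide = anyLarge-PolyTime π₁ (π₁ ∘ᵖ π₂ {nats}) (π₁ ∘ᵖ π₂ {nats} ∘ᵖ π₂ {nats})
                           (π₂ {edges} ∘ᵖ π₂ {nats} ∘ᵖ π₂ {nats})

-- Correctness of the algorithm

-- `m ≡ᵇ n` is by definition `does (m ≟ n)`.
≡ᵇ-true : ∀ {m n} → m ≡ n → (m ≡ᵇ n) ≡ true
≡ᵇ-true {m} {n} = dec-true (m ≟ n)

≡ᵇ-true⁻ : ∀ {m n} → (m ≡ᵇ n) ≡ true → m ≡ n
≡ᵇ-true⁻ {m} {n} eq = ≡ᵇ⇒≡ m n (subst T (sym eq) tt)

true⇔true⇒≡ : ∀ {a b} → (a ≡ true → b ≡ true) → (b ≡ true → a ≡ true) → a ≡ b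
true⇔true⇒≡ {true}  {b}     f g = sym (f refl)
true⇔true⇒≡ {false} {true}  f g = g refl
true⇔true⇒≡ {false} {false} f g = refl

module _ {A B C : Set} {P : A → Set} (P? : Decidable P) (p : B → Bool) (f : B → C) (h : A → B)
         (p≡ : ∀ x → p (h x) ≡ does (P? x)) where

  -- Relates the loops over encoded numbers to `filter` over vertices, with `h` the passage from
  -- vertices to numbers.
  foldr-filter : ∀ xs → foldr (λ x ys → if p x then f x ∷ ys else ys) [] (map h xs) ≡
                        map (λ x → f (h x)) (filter P? xs)
  foldr-filter []       = refl
  foldr-filter (x ∷ xs) with P? x | p≡ x
  ... | yes _ | eq rewrite eq = cong (f (h x) ∷_) (foldr-filter xs)
  ... | no _  | eq rewrite eq = foldr-filter xs

module _ {A : Set} (p : ℕ → Bool) (h : A → ℕ) where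

  foldr-∧ : List A → Bool
  foldr-∧ xs = foldr (λ i b → if b then p i else false) true (map h xs)

  foldr-∧⁺ : ∀ xs → (∀ x → x ∈ₗ xs → p (h x) ≡ true) → foldr-∧ xs ≡ true
  foldr-∧⁺ []       all = refl
  foldr-∧⁺ (x ∷ xs) all rewrite foldr-∧⁺ xs (λ y → all y ∘ there) = all x (here refl)

  foldr-∧⁻ : ∀ xs → foldr-∧ xs ≡ true → ∀ {x} → x ∈ₗ xs → p (h x) ≡ true
  foldr-∧⁻ (x ∷ xs) eq x∈ with foldr-∧ xs in eq′
  foldr-∧⁻ (x ∷ xs) eq (here refl) | true = eq
  foldr-∧⁻ (x ∷ xs) eq (there x∈)  | true = foldr-∧⁻ xs eq′ x∈

  foldr-∨ : List A → Bool
  foldr-∨ xs = foldr (λ i b → if b then true else p i) false (map h xs)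

  foldr-∨⁺ : ∀ {xs x} → x ∈ₗ xs → p (h x) ≡ true → foldr-∨ xs ≡ true
  foldr-∨⁺ {x ∷ xs} x∈ eq with foldr-∨ xs in eq′
  foldr-∨⁺ {x ∷ xs} x∈          eq | true  = refl
  foldr-∨⁺ {x ∷ xs} (here refl) eq | false = eq
  foldr-∨⁺ {x ∷ xs} (there x∈)  eq | false = contradiction (trans (sym eq′) (foldr-∨⁺ x∈ eq)) λ ()

  foldr-∨⁻ : ∀ xs → foldr-∨ xs ≡ true → ∃[ x ] p (h x) ≡ true
  foldr-∨⁻ (x ∷ xs) eq with foldr-∨ xs in eq′
  ... | true  = foldr-∨⁻ xs eq′
  ... | false = x , eq

count-length : ∀ l R → proj₁ (count l R) ≡ length R
count-length l []      = refl
count-length l (x ∷ R) = cong suc (count-length l R)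

count⇒≤ : ∀ {l} R → proj₂ (count l R) ≡ true → l ≤ length R
count⇒≤ {l} (x ∷ R) eq with proj₂ (count l R) in eq′
... | true  = ≤-trans (count⇒≤ R eq′) (n≤1+n _)
... | false = ≤-reflexive (sym (trans (cong suc (sym (count-length l R))) (≡ᵇ-true⁻ eq)))

-- If the flag is not yet set, the tail has by induction fewer than `l` elements, so the count
-- reaches exactly `l` at the head. Positivity settles the empty list, where the flag is false.
≤⇒count : ∀ {l} → NonZero l → ∀ R → l ≤ length R → proj₂ (count l R) ≡ true
≤⇒count {suc l} _ []      ()
≤⇒count {l} l>0 (x ∷ R) l≤ with proj₂ (count l R) in eq
... | true  = refl
... | false = ≡ᵇ-true (≤-antisym (≤-trans (≤-reflexive (cong suc (count-length l R))) (≰⇒> l≰))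
                                 (≤-trans l≤ (≤-reflexive (cong suc (sym (count-length l R))))))
  where
  l≰ : ¬ (l ≤ length R)
  l≰ l≤R = contradiction (trans (sym eq) (≤⇒count l>0 R l≤R)) λ ()

-- Subsets as lists of vertices

elements : ∀ {n} → Subset n → List (Fin n)
elements {n} s = filter (_∈? s) (allFin n)

length-elements : ∀ {n} (s : Subset n) → length (elements s) ≡ ∣ s ∣
length-elements []      = refl
length-elements {suc n} (b ∷ s) = trans (cong (λ xs → length (filter (_∈? (b ∷ s)) (Fin.zero ∷ xs)))
                                 (sym (List.map-tabulate id Fin.suc)))
                          (cons b)
  where
  tail : ∀ b xs → length (filter (_∈? (b ∷ s)) (map Fin.suc xs)) ≡ length (filter (_∈? s) xs)
  tail b []       = refl
  tail b (x ∷ xs) with does (x ∈? s)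
  ... | true  = cong suc (tail b xs)
  ... | false = tail b xs
  cons : ∀ b → length (filter (_∈? (b ∷ s)) (Fin.zero ∷ map Fin.suc (allFin n))) ≡ ∣ b ∷ s ∣
  cons true  = cong suc (trans (tail true (allFin n)) (length-elements s))
  cons false = trans (tail false (allFin n)) (length-elements s)

does-∈?-tabulate : ∀ {n} (f : Fin n → Bool) w → f w ≡ does (w ∈? Vec.tabulate f)
does-∈?-tabulate f Fin.zero with f Fin.zero
... | true  = refl
... | false = refl
does-∈?-tabulate f (Fin.suc w) = does-∈?-tabulate (f ∘ Fin.suc) w

-- Labels, classes and leaders

module _ (G : ColouredGraph) where

  open ColouredGraph G

  triple : Fin #E → ℕ × ℕ × ℕ
  triple e = toℕ (proj₁ (ends e)) , toℕ (proj₂ (ends e)) , toℕ (colour e)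

  Vs Cs : List ℕ
  Vs = map toℕ (allFin #V)
  Cs = map toℕ (allFin #C)

  Es : List (ℕ × ℕ × ℕ)
  Es = map triple (allFin #E)

  adjacent-sym : ∀ {i u v} → AvoidingAdjacent i u v → AvoidingAdjacent i v u
  adjacent-sym (e , c≢i , inj₁ eq) = e , c≢i , inj₂ eq
  adjacent-sym (e , c≢i , inj₂ eq) = e , c≢i , inj₁ eq

  avoiding-sym : ∀ {i u v} → AvoidingConnected i u v → AvoidingConnected i v u
  avoiding-sym = Star.reverse adjacent-sym

  -- Stronger than soundness for equal labels, so that the induction goes through: a label is itself
  -- a vertex, connected to those that carry it.
  find-sound : ∀ i es u → ∃[ w ] find (merges (toℕ i) (map triple es)) (toℕ u) ≡ toℕ w × AvoidingConnected i u w
  find-sound i []       u = u , refl , ε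
  find-sound i (e ∷ es) u with toℕ (colour e) ≡ᵇ toℕ i in c≡ᵇi
  ... | true  = find-sound i es u
  ... | false with find-sound i es u | find-sound i es (proj₁ (ends e)) | find-sound i es (proj₂ (ends e))
  ... | w , eq , u~w | w₁ , eq₁ , u₁~w₁ | w₂ , eq₂ , u₂~w₂
    with find (merges (toℕ i) (map triple es)) (toℕ u) ≡ᵇ
         find (merges (toℕ i) (map triple es)) (toℕ (proj₁ (ends e))) in same
  ... | false = w , eq , u~w
  -- `u` and the first endpoint share a label, so the path goes from `u` to it, back to that
  -- endpoint, across `e`, and on to the label of the second endpoint.
  ... | true  = w₂ , eq₂ , u~w ◅◅ subst (λ w → AvoidingConnected i w w₂) (sym w≡w₁)
                  (avoiding-sym u₁~w₁ ◅◅ (e , c≢i , inj₁ refl) ◅ u₂~w₂)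
    where
    w≡w₁ : w ≡ w₁
    w≡w₁ = toℕ-injective (trans (sym eq) (trans (≡ᵇ-true⁻ same) eq₁))
    c≢i : colour e ≢ i
    c≢i refl = contradiction (trans (sym c≡ᵇi) (≡ᵇ-true {toℕ i} refl)) λ ()

  -- One more replacement applies the same function to all labels.
  merge-preserves : ∀ i e M {x y} → find M x ≡ find M y → find (merge i e M) x ≡ find (merge i e M) y
  merge-preserves i (u , v , c) M eq with c ≡ᵇ i
  ... | true  = eq
  ... | false = cong (λ x → if x ≡ᵇ find M u then find M v else x) eq

  merge-joins : ∀ i u v c M → c ≢ i → find (merge i (u , v , c) M) u ≡ find (merge i (u , v , c) M) v
  merge-joins i u v c M c≢i with c ≡ᵇ i in c≡ᵇi
  ... | true  = contradiction (≡ᵇ-true⁻ c≡ᵇi) c≢i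
  -- The label of `u` becomes that of `v`; the label of `v` is either kept or, if it equals that of
  -- `u`, replaced by itself.
  ... | false rewrite ≡ᵇ-true {find M u} refl with find M v ≡ᵇ find M u
  ... | true  = refl
  ... | false = refl

  -- The merge of `e` joins its endpoints, and the merges made after it preserve this.
  find-complete-edge : ∀ {i e es} → e ∈ₗ es → colour e ≢ i →
    let M = merges (toℕ i) (map triple es) in
    find M (toℕ (proj₁ (ends e))) ≡ find M (toℕ (proj₂ (ends e)))
  find-complete-edge {i} {e} {.e ∷ es} (here refl) c≢i =
    merge-joins (toℕ i) _ _ _ (merges (toℕ i) (map triple es)) (c≢i ∘ toℕ-injective)
  find-complete-edge {i} {e} {e′ ∷ es} (there e∈) c≢i =
    merge-preserves (toℕ i) (triple e′) (merges (toℕ i) (map triple es)) (find-complete-edge e∈ c≢i)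

  find-complete : ∀ {i u v} → AvoidingConnected i u v →
    find (merges (toℕ i) Es) (toℕ u) ≡ find (merges (toℕ i) Es) (toℕ v)
  find-complete ε = refl
  find-complete ((e , c≢i , inj₁ refl) ◅ path) =
    trans (find-complete-edge (Membership.∈-allFin e) c≢i) (find-complete path)
  find-complete ((e , c≢i , inj₂ refl) ◅ path) =
    trans (sym (find-complete-edge (Membership.∈-allFin e) c≢i)) (find-complete path)

  connectedᵇ : Fin #V → Fin #V → Bool
  connectedᵇ v w = connected Cs Es (toℕ v) (toℕ w)

  sameLabel : Fin #V → Fin #V → ℕ → Bool
  sameLabel v w i = find (merges i Es) (toℕ v) ≡ᵇ find (merges i Es) (toℕ w)

  connectedᵇ-complete : ∀ {v w} → ColourAvoidingConnected v w → connectedᵇ v w ≡ true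
  connectedᵇ-complete {v} {w} conn =
    foldr-∧⁺ (sameLabel v w) toℕ (allFin #C) (λ i _ → ≡ᵇ-true (find-complete (conn i)))

  connectedᵇ-sound : ∀ {v w} → connectedᵇ v w ≡ true → ColourAvoidingConnected v w
  connectedᵇ-sound {v} {w} eq i with find-sound i (allFin #E) v | find-sound i (allFin #E) w
  ... | x , v≡ , v~x | y , w≡ , w~y = v~x ◅◅ subst (λ x → AvoidingConnected i x w) (sym x≡y) (avoiding-sym w~y)
    where
    x≡y : x ≡ y
    x≡y = toℕ-injective (trans (sym v≡)
      (trans (≡ᵇ-true⁻ (foldr-∧⁻ (sameLabel v w) toℕ (allFin #C) eq (Membership.∈-allFin i))) w≡))

  class : Fin #V → Subset #V
  class v = Vec.tabulate (connectedᵇ v)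

  ∈-class : ∀ v w → w ∈ class v ⇔ ColourAvoidingConnected v w
  ∈-class v w = mk⇔
    (λ w∈ → connectedᵇ-sound (trans (sym (Vec.lookup∘tabulate (connectedᵇ v) w)) (Vec.[]=⇒lookup w∈)))
    (λ conn → Vec.lookup⇒[]= w (class v)
      (trans (Vec.lookup∘tabulate (connectedᵇ v) w) (connectedᵇ-complete conn)))

  component≡ : ∀ v → component Vs Cs Es (toℕ v) ≡ map toℕ (elements (class v))
  component≡ v = foldr-filter (_∈? class v) (connected Cs Es (toℕ v)) id toℕ
    (does-∈?-tabulate (connectedᵇ v)) (allFin #V)

  leaderOf : Subset #V → ℕ
  leaderOf s = leader (map toℕ (elements s))

  IsLeader : Fin #V → Set
  IsLeader v = leaderOf (class v) ≡ toℕ v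

  isLeader? : Decidable IsLeader
  isLeader? v = leaderOf (class v) ≟ toℕ v

  leaders : List (Fin #V)
  leaders = filter isLeader? (allFin #V)

  classes : List (Subset #V)
  classes = map class leaders

  components≡ : components Vs Cs Es ≡ map (map toℕ) (map elements classes)
  components≡ = trans
    (foldr-filter isLeader? (λ v → leader (component Vs Cs Es v) ≡ᵇ v) (component Vs Cs Es) toℕ
      (λ v → cong (λ R → leader R ≡ᵇ toℕ v) (component≡ v)) (allFin #V))
    (trans (List.map-cong component≡ leaders)
    (trans (List.map-∘ leaders) (cong (map (map toℕ)) (List.map-∘ leaders))))

  class-cong : ∀ {v w} → ColourAvoidingConnected v w → class v ≡ class w
  class-cong v~w = Vec.tabulate-cong (λ x → true⇔true⇒≡
    (λ eq → connectedᵇ-complete (λ i → avoiding-sym (v~w i) ◅◅ connectedᵇ-sound eq i))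
    (λ eq → connectedᵇ-complete (λ i → v~w i ◅◅ connectedᵇ-sound eq i)))

  isComponent-class : ∀ v → IsComponent (class v)
  isComponent-class v = v , ∈-class v

  isComponent⇒class : ∀ {s} → IsComponent s → ∃[ v ] s ≡ class v
  isComponent⇒class {s} (v , s⇔) = v , ⊆-antisym
    (λ {w} w∈ → Equivalence.from (∈-class v w) (Equivalence.to (s⇔ w) w∈))
    (λ {w} w∈ → Equivalence.from (s⇔ w) (Equivalence.to (∈-class v w) w∈))

  -- The first element `r` of the class of `v` has the same class, so it is also first in its own.
  class-leader : ∀ v → ∃[ r ] IsLeader r × class v ≡ class r
  class-leader v with elements (class v) in eq
    | Membership.∈-filter⁺ (_∈? class v) (Membership.∈-allFin v)
        (Equivalence.from (∈-class v v) (λ i → ε))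
  -- `v` lies in its own class, which rules out the empty list.
  ... | r ∷ rs | _ = r , trans (cong leaderOf (sym v≡r)) (cong (leader ∘ map toℕ) eq) , v≡r
    where
    r∈ : r ∈ class v
    r∈ = proj₂ (Membership.∈-filter⁻ (_∈? class v) {xs = allFin #V} (subst (r ∈ₗ_) (sym eq) (here refl)))
    v≡r : class v ≡ class r
    v≡r = class-cong (Equivalence.to (∈-class v r) r∈)

  ∈-classes : ∀ s → s ∈ₗ classes ⇔ IsComponent s
  ∈-classes s = mk⇔ to from
    where
    to : s ∈ₗ classes → IsComponent s
    to s∈ with Membership.∈-map⁻ class s∈
    ... | v , _ , refl = isComponent-class v
    from : IsComponent s → s ∈ₗ classes
    from comp with isComponent⇒class comp
    ... | v , refl with class-leader v
    ... | r , lead , v≡r = subst (_∈ₗ classes) (sym v≡r)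
      (Membership.∈-map⁺ class (Membership.∈-filter⁺ isLeader? (Membership.∈-allFin r) lead))

  -- A class is determined by its leader.
  classes-unique : Unique classes
  classes-unique = Unique.map⁻ {f = leaderOf} (subst Unique leaders≡
    (Unique.map⁺ toℕ-injective (Unique.filter⁺ isLeader? (Unique.allFin⁺ #V))))
    where
    leaders≡ : map toℕ leaders ≡ map leaderOf classes
    leaders≡ = trans (List.map-cong-local (All.map sym (All.all-filter isLeader? (allFin #V))))
                     (List.map-∘ leaders)

  listsComponents : ListsComponents classes
  listsComponents = classes-unique , ∈-classes

  anyLarge-correct : ∀ {l} → NonZero l →
                     anyLarge Vs Cs Es l ≡ true ⇔ (∃[ s ] IsComponent s × l ≤ ∣ s ∣)
  anyLarge-correct {l} l>0 = mk⇔ to from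
    where
    large : ℕ → Bool
    large v = proj₂ (count l (component Vs Cs Es v))
    size≡ : ∀ v → length (component Vs Cs Es (toℕ v)) ≡ ∣ class v ∣
    size≡ v = trans (cong length (component≡ v))
      (trans (List.length-map toℕ (elements (class v))) (length-elements (class v)))
    to : anyLarge Vs Cs Es l ≡ true → ∃[ s ] IsComponent s × l ≤ ∣ s ∣
    to eq with foldr-∨⁻ large toℕ (allFin #V) eq
    ... | v , eq′ = class v , isComponent-class v ,
      ≤-trans (count⇒≤ (component Vs Cs Es (toℕ v)) eq′) (≤-reflexive (size≡ v))
    from : ∃[ s ] IsComponent s × l ≤ ∣ s ∣ → anyLarge Vs Cs Es l ≡ true
    from (s , comp , l≤) with isComponent⇒class comp
    ... | v , refl = foldr-∨⁺ large toℕ (Membership.∈-allFin v)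
      (≤⇒count l>0 (component Vs Cs Es (toℕ v)) (≤-trans l≤ (≤-reflexive (sym (size≡ v)))))

-- Agreement with the encodings of the statement

nat-encodeℕ : ∀ n → enc nat n ≡ map inj₁ (encodeℕ n)
nat-encodeℕ n = sym (List.map-++ inj₁ (digits (fromℕ n)) [ comma ])

list-concatMap : ∀ {X : Set} {t} (e : Listable (inj₁ t) A) {g : X → List Symbol} {h : X → Carrier A} →
                 (∀ x → enc A (h x) ≡ map inj₁ (g x)) →
                 ∀ xs → enc (list e) (map h xs) ≡ map inj₁ (concatMap g xs ++ [ t ])
list-concatMap e h≡ []       = refl
list-concatMap {A} {t = t} e {g} {h} h≡ (x ∷ xs) = begin
  enc (list e) (h x ∷ map h xs)                              ≡⟨ enc-∷ e (h x) (map h xs) ⟩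
  enc A (h x) ++ enc (list e) (map h xs)                     ≡⟨ cong₂ _++_ (h≡ x) (list-concatMap e h≡ xs) ⟩
  map inj₁ (g x) ++ map inj₁ (concatMap g xs ++ [ t ])       ≡⟨ List.map-++ inj₁ (g x) _ ⟨
  map inj₁ (g x ++ concatMap g xs ++ [ t ])                  ≡⟨ cong (map inj₁) (List.++-assoc (g x) _ _) ⟨
  map inj₁ (concatMap g (x ∷ xs) ++ [ t ])                   ∎
  where open ≡-Reasoning

nats-encode : ∀ {n} (xs : List (Fin n)) →
              enc nats (map toℕ xs) ≡ map inj₁ (concatMap encodeFin xs ++ [ semicolon ])
nats-encode = list-concatMap natˢ (λ x → nat-encodeℕ (toℕ x))

map-++² : ∀ (u v w : List Symbol) → map {B = Sym} inj₁ ((u ++ v) ++ w) ≡ map inj₁ u ++ map inj₁ v ++ map inj₁ w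
map-++² u v w = trans (List.map-++ inj₁ (u ++ v) w)
  (trans (cong (_++ map inj₁ w) (List.map-++ inj₁ u v)) (List.++-assoc (map inj₁ u) _ _))

module _ (G : ColouredGraph) where

  open ColouredGraph G

  -- Stands for the edge encoding local to `encodeGraph`, with which it agrees definitionally, by
  -- eta for pairs.
  encodeTriple : Fin #E → List Symbol
  encodeTriple e = encodeFin (proj₁ (ends e)) ++ encodeFin (proj₂ (ends e)) ++ encodeFin (colour e)

  edges-encode : enc edges (Es G) ≡ map inj₁ (concatMap encodeTriple (allFin #E) ++ [ semicolon ])
  edges-encode = list-concatMap edgeˢ (λ e → begin
    enc nat (toℕ (proj₁ (ends e))) ++ enc nat (toℕ (proj₂ (ends e))) ++ enc nat (toℕ (colour e))
      ≡⟨ cong₂ _++_ (nat-encodeℕ (toℕ (proj₁ (ends e)))) (cong₂ _++_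
             (nat-encodeℕ (toℕ (proj₂ (ends e)))) (nat-encodeℕ (toℕ (colour e)))) ⟩
    map inj₁ (encodeFin (proj₁ (ends e))) ++ map inj₁ (encodeFin (proj₂ (ends e))) ++ map inj₁ (encodeFin (colour e))
      ≡⟨ cong (map inj₁ (encodeFin (proj₁ (ends e))) ++_) (List.map-++ inj₁ (encodeFin (proj₂ (ends e))) _) ⟨
    map inj₁ (encodeFin (proj₁ (ends e))) ++ map inj₁ (encodeFin (proj₂ (ends e)) ++ encodeFin (colour e))
      ≡⟨ List.map-++ inj₁ (encodeFin (proj₁ (ends e))) _ ⟨
    map inj₁ (encodeTriple e) ∎) (allFin #E)
    where open ≡-Reasoning

  graph-encode : enc graphᶜ (Vs G , Cs G , Es G) ≡ map inj₁ (encodeGraph G)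
  graph-encode = begin
    enc nats (Vs G) ++ enc nats (Cs G) ++ enc edges (Es G)
      ≡⟨ cong₂ _++_ (nats-encode (allFin #V)) (cong₂ _++_ (nats-encode (allFin #C)) edges-encode) ⟩
    map inj₁ (v ++ [ semicolon ]) ++ map inj₁ (c ++ [ semicolon ]) ++ map inj₁ (e ++ [ semicolon ])
      ≡⟨ map-++² (v ++ [ semicolon ]) (c ++ [ semicolon ]) (e ++ [ semicolon ]) ⟨
    map inj₁ (((v ++ [ semicolon ]) ++ c ++ [ semicolon ]) ++ e ++ [ semicolon ])
      ≡⟨ cong (map inj₁) (trans (List.++-assoc (v ++ [ semicolon ]) _ _)
           (trans (List.++-assoc v _ _) (cong (λ w → v ++ semicolon ∷ w) (List.++-assoc c _ _)))) ⟩
    map inj₁ (encodeGraph G) ∎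
    where
    open ≡-Reasoning
    v = concatMap encodeFin (allFin #V)
    c = concatMap encodeFin (allFin #C)
    e = concatMap encodeTriple (allFin #E)

  search-encode : enc natLists (components (Vs G) (Cs G) (Es G)) ≡
                  map inj₁ (encodeSubsets (classes G)) ++ inj₂ end ∷ []
  search-encode = cong (_++ [ inj₂ end ]) (trans
    (cong (concatMap (enc nats)) (trans (components≡ G) (sym (List.map-∘ (classes G)))))
    (begin
      concatMap (enc nats) (map (λ s → map toℕ (elements s)) (classes G))
        ≡⟨ List.concatMap-map (enc nats) _ (classes G) ⟩
      concatMap (λ s → enc nats (map toℕ (elements s))) (classes G)
        ≡⟨ List.concatMap-cong (λ s → nats-encode (elements s)) (classes G) ⟩
      concatMap (λ s → map inj₁ (encodeSubset s)) (classes G)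
        ≡⟨ List.map-concatMap inj₁ encodeSubset (classes G) ⟨
      map inj₁ (encodeSubsets (classes G)) ∎))
    where open ≡-Reasoning

instance-encode : ∀ x → let open Instance x in
  enc instanceᶜ (Vs input , Cs input , Es input , l) ≡ map inj₁ (encodeInstance x)
instance-encode x = begin
  v ++ c ++ e ++ enc nat l                ≡⟨ cong (v ++_) (List.++-assoc c e _) ⟨
  v ++ (c ++ e) ++ enc nat l              ≡⟨ List.++-assoc v (c ++ e) _ ⟨
  (v ++ c ++ e) ++ enc nat l              ≡⟨ cong₂ _++_ (graph-encode input) (nat-encodeℕ l) ⟩
  map inj₁ (encodeGraph input) ++ map inj₁ (encodeℕ l)
                                          ≡⟨ List.map-++ inj₁ (encodeGraph input) (encodeℕ l) ⟨
  map inj₁ (encodeInstance x)             ∎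
  where
  open Instance x
  open ≡-Reasoning
  v = enc nats (Vs input)
  c = enc nats (Cs input)
  e = enc edges (Es input)

-- From programs to statements about Turing machines

machine-polyTime :
  ∀ {I : Set} {f} (F : PolyTime A B f) (encode : I → List Symbol) (x : I → Carrier A) →
  (∀ i → enc A (x i) ≡ map inj₁ (encode i)) →
  RunsInPolyTime encode (machine (prog F)) λ i c →
    let open TuringMachine (machine (prog F)) in
    accepting (state c) ≡ isSym (inj₁ one) (head (enc B (f (x i))))
    × Represents (Vec.head (tapes c)) (enc B (f (x i)))
-- The summand 1 is the step that forms the verdict.
machine-polyTime {A} {B} {f = f} F encode x enc≡ with eval≤an^d+a (time F ⊕ con 1)
... | a , d , bound = a , d , λ i →
  let t , c , halts , t≤ , accepts , rep = machine-correct (prog F) (runs i)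
  in t , c , halts , ≤-trans t≤ (bound (length (encode i))) , accepts , rep
  where
  runs : ∀ i → prog F ⊢ map inj₁ (encode i) ∷ [] ∷ [] ∷ [] ⇓[ eval (time F) (length (encode i)) ]
               enc B (f (x i)) ∷ [] ∷ [] ∷ []
  runs i = restart (cong (λ w → w ∷ [] ∷ [] ∷ []) (trans (List.++-identityʳ _) (enc≡ i)))
    (retarget (cong (λ w → w ∷ [] ∷ [] ∷ []) (List.++-identityʳ _))
    (weaken (≤-reflexive (cong (eval (time F)) (trans (cong length (enc≡ i)) (List.length-map inj₁ (encode i)))))
      (run F (x i) [] [] [])))

isOne-boolSym : ∀ b → isSym (inj₁ one) (just (boolSym b)) ≡ b
isOne-boolSym true  = refl
isOne-boolSym false = refl

PolyTime⇒InP :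
  ∀ {I : Set} {f} → PolyTime A bool f → (encode : I → List Symbol) (x : I → Carrier A) →
  (∀ i → enc A (x i) ≡ map inj₁ (encode i)) →
  {Yes : I → Set} → (∀ i → f (x i) ≡ true ⇔ Yes i) → InP encode Yes
PolyTime⇒InP {f = f} F encode x enc≡ {Yes} correct with machine-polyTime F encode x enc≡
... | a , d , runs = machine (prog F) , a , d , λ i →
  let t , c , halts , t≤ , accepts , _ = runs i
      accepts′ = trans accepts (isOne-boolSym (f (x i)))
  in t , c , halts , t≤ , mk⇔ (λ eq → Equivalence.to (correct i) (trans (sym accepts′) eq))
                              (λ yes → trans accepts′ (Equivalence.from (correct i) yes))

PolyTime⇒SolvableInPolyTime :
  ∀ {I : Set} {f} → PolyTime A B f → (encode : I → List Symbol) (x : I → Carrier A) →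
  (∀ i → enc A (x i) ≡ map inj₁ (encode i)) →
  {O : I → Set} {encodeO : ∀ i → O i → List Symbol} {IsSolution : ∀ i → O i → Set} →
  (o : ∀ i → O i) → (∀ i → IsSolution i (o i)) →
  (∀ i → enc B (f (x i)) ≡ map inj₁ (encodeO i (o i)) ++ inj₂ end ∷ []) →
  SolvableInPolyTime encode encodeO IsSolution
PolyTime⇒SolvableInPolyTime F encode x enc≡ o solves encodeO≡ with machine-polyTime F encode x enc≡
... | a , d , runs = machine (prog F) , a , d , λ i →
  let t , c , halts , t≤ , _ , rep = runs i
  in t , c , halts , t≤ , o i , solves i ,
     output-represents (prog F) {c} (subst (Represents _) (encodeO≡ i) rep)

theorem1 : InP encodeInstance HasLargeComponent
    × SolvableInPolyTime encodeGraph (λ G → encodeSubsets) ColouredGraph.ListsComponents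
theorem1 =
  PolyTime⇒InP decide encodeInstance
    (λ i → let open Instance i in Vs input , Cs input , Es input , l) instance-encode
    (λ i → anyLarge-correct (Instance.input i) (Instance.l>0 i)) ,
  PolyTime⇒SolvableInPolyTime search encodeGraph
    (λ G → Vs G , Cs G , Es G) graph-encode classes listsComponents search-encode
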